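{- Let $g(x)=\alpha x^{q^k}+\beta x$ with $\alpha\in\mathbb{F}_{q^n}^*$, $\beta\in\mathbb{F}_{q^n}$, $1\le k<n$, let $f(y)=a_dy^{q^d}$ with $a_d\in\mathbb{F}_{q^n}^*$, $0\le d<n$, and let $0\le h<n$ with $h\ne d$. (1) If $\beta=0$, then $L_g\cap L_f\ne\emptyset$ if and only if $\mathrm{N}_{q^n/q^e}(a_d/\alpha)=1$, where $e=\gcd(n,k,d-h)$. (2) If $\beta\neq0$ and $k+|d-h|\le n/2$, then $L_g\cap L_f\neq\emptyset$.
   Context: Let $q$ be a prime power, $n\ge2$. For $e\mid n$, $\mathrm{N}_{q^n/q^e}(x)=x^{(q^n-1)/(q^e-1)}$; $\gcd$ is taken positive. For $q$-polynomials $g,f$ over $\mathbb{F}_{q^n}$ and an integer $0\le h<n$: $L_g=\{\langle(x,g(x))\rangle_{\mathbb{F}_{q^n}}:x\in\mathbb{F}_{q^n}^*\}$ and $L_f=\{\langle(y^{q^h},f(y))\rangle_{\mathbb{F}_{q^n}}:y\in\mathbb{F}_{q^n}^*\}$, points of $\mathrm{PG}(1,q^n)$. -}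

module Defs where

open import Algebra.Bundles using (CommutativeRing)
open import Algebra.Definitions using (Invertible)
open import Algebra.Module.Bundles using (Module)
import Algebra.Properties.Semiring.Exp as Exp
import Algebra.Module.Construct.DirectProduct as DirectProduct
import Algebra.Module.Construct.TensorUnit as TensorUnit
open import Data.Fin.Base using (Fin)
open import Data.Nat.Base as ℕ using (ℕ; NonZero; _≤_; _<_)
import Data.Nat.DivMod as ℕ
open import Data.Nat.Divisibility using (_∣_; 0∣⇒≡0)
import Data.Nat.Properties as ℕ
open import Data.Nat.Primality using (Prime; prime⇒nonTrivial)
open import Data.Product.Base using (Σ; ∃-syntax; _×_; _,_; proj₁)
open import Function.Bundles using (Inverse)
open import Level using (Level; _⊔_) renaming (suc to lsuc)
open import Relation.Binary.PropositionalEquality as ≡ using (_≡_)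
open import Relation.Nullary.Negation using (¬_)
open import Relation.Unary using (Pred; _≐_)

record PrimePower (q : ℕ) : Set where
  field
    p r     : ℕ
    p-prime : Prime p
    1≤r     : 1 ≤ r
    q≡p^r   : q ≡ p ℕ.^ r

primePower⇒1<q : ∀ {q} → PrimePower q → 1 < q
primePower⇒1<q pp = ≡.subst (1 <_) (≡.sym q≡p^r)
  (ℕ.^-monoʳ-< p (ℕ.nonTrivial⇒n>1 p {{prime⇒nonTrivial p-prime}}) 1≤r)
  where open PrimePower pp

q^e∸1-nonZero : ∀ {q e n} → PrimePower q → 2 ≤ n → e ∣ n → NonZero (q ℕ.^ e ℕ.∸ 1)
q^e∸1-nonZero {q} {ℕ.zero} {n} pp 2≤n e∣n with 0∣⇒≡0 e∣n
q^e∸1-nonZero {q} {ℕ.zero} pp () e∣n | ≡.refl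
q^e∸1-nonZero {q} {ℕ.suc e} pp 2≤n e∣n =
  ℕ.>-nonZero (ℕ.m<n⇒0<n∸m (ℕ.^-monoʳ-< q (primePower⇒1<q pp) (ℕ.z<s {e})))

-- Equality in the field is the setoid equality of the ring, so "having
-- exactly N elements" means N equivalence classes.
record FiniteField (N : ℕ) (c ℓ : Level) : Set (lsuc (c ⊔ ℓ)) where
  field
    commutativeRing : CommutativeRing c ℓ

  open CommutativeRing commutativeRing public

  field
    1≉0         : 1# ≉ 0#
    invertible  : ∀ {x} → x ≉ 0# → Invertible _≈_ 1# _*_ x
    enumeration : Inverse setoid (≡.setoid (Fin N))

  open Exp semiring public using (_^_)

  _÷_ : Carrier → ∀ {y} → y ≉ 0# → Carrier
  x ÷ y≉0 = x * proj₁ (invertible y≉0)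

module ProjectiveLine {N c ℓ} (F : FiniteField N c ℓ) where
  open FiniteField F

  plane : Module commutativeRing c ℓ
  plane = DirectProduct.⟨module⟩ TensorUnit.⟨module⟩ TensorUnit.⟨module⟩

  open Module plane using (Carrierᴹ; _≈ᴹ_; _*ₗ_; 0ᴹ)

  ⟨_⟩ : Carrierᴹ → Pred Carrierᴹ (c ⊔ ℓ)
  ⟨ v ⟩ w = ∃[ s ] s *ₗ v ≈ᴹ w

  -- A point of PG(1,N) is a one-dimensional subspace of the plane, with
  -- subspaces compared extensionally (_≐_); sets of points below respect this.
  Point : Set (lsuc (c ⊔ ℓ))
  Point = Σ (Pred Carrierᴹ (c ⊔ ℓ)) λ S → ∃[ v ] (¬ v ≈ᴹ 0ᴹ) × S ≐ ⟨ v ⟩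

module LinearSets {q n c ℓ} (q-primePower : PrimePower q) (2≤n : 2 ≤ n)
                  (F : FiniteField (q ℕ.^ n) c ℓ) where
  open FiniteField F
  open ProjectiveLine F public

  norm : ∀ e → e ∣ n → Carrier → Carrier
  norm e e∣n x = x ^ ((q ℕ.^ n ℕ.∸ 1) ℕ./ (q ℕ.^ e ℕ.∸ 1))
    where instance _ = q^e∸1-nonZero q-primePower 2≤n e∣n

  L : (Carrier → Carrier) → Pred Point (c ⊔ ℓ)
  L g (S , _) = ∃[ x ] x ≉ 0# × S ≐ ⟨ x , g x ⟩

  L[_] : ℕ → (Carrier → Carrier) → Pred Point (c ⊔ ℓ)
  L[ h ] f (S , _) = ∃[ y ] y ≉ 0# × S ≐ ⟨ y ^ (q ℕ.^ h) , f y ⟩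

-- Two points ⟨(x, g x)⟩ and ⟨(y^(q^h), f y)⟩ coincide iff g x · y^(q^h) = x · f y.
-- Frobenius powers being bijective, for some x and y this is the solvability of
--   α x^(q^k − 1) + β = a w^(q^m − 1),   m = |d − h|,   x, w ≠ 0.
--
-- For β = 0 it says that a/α lies in the subgroup of products of (q^k − 1)-th and
-- (q^m − 1)-th powers.  The j for which this subgroup contains all (q^j − 1)-th
-- powers include n, k, m and are closed under sums and differences, hence include
-- e = gcd(n, k, m); and the (q^e − 1)-th powers are the elements of norm 1.
--
-- For β ≠ 0, write Q = q^n, A = q^k − 1, B = q^m − 1 and count the solutions
-- x, w ≠ 0 of s x^A + t w^B = 1 for all s, t at once.  Since two distinct lines
-- meet in at most one point, the counts have small variance around Q − 2.  If
-- (s₀, t₀) had no solution, then neither would any (s₀ z^A, t₀ z′^B), and these at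
-- least (Q − 1)²/AB pairs would contradict the variance bound, as (AB + 3)² ≤ Q.
module Submission where

open import Defs
import Algebra.Properties.CommutativeMonoid.Sum as MonoidSum
import Algebra.Properties.CommutativeSemiring.Exp as Exp
import Algebra.Properties.Group as GroupProperties
import Algebra.Properties.Semiring.Sum as SemiringSum
import Algebra.Solver.Ring.NaturalCoefficients.Default as RingSolver
open import Data.Fin.Base using (Fin; zero; suc; punchIn; punchOut)
open import Data.Fin.Permutation as Perm using (Permutation; _⟨$⟩ʳ_)
import Data.Fin.Properties as Fin
open import Data.List.Base using (List; []; _∷_)
open import Data.Nat.Base as ℕ using (ℕ; zero; suc; _≤_; _<_; z≤n; s≤s)
import Data.Nat.DivMod as ℕ
open import Data.Nat.Divisibility using (_∣_; divides; _∣0; ∣-refl; ∣-trans; ∣m∣n⇒∣m+n; ∣n⇒∣m*n)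
open import Data.Nat.GCD using (gcd; gcd[m,n]∣m; gcd[m,n]∣n; gcd[m,n]≢0; gcd-GCD; module Bézout)
import Data.Nat.Properties as ℕ
open import Data.Nat.Tactic.RingSolver using (solve-∀)
open import Data.Product.Base using (∃-syntax; _×_; _,_; proj₁; proj₂)
open import Data.Sum.Base using (_⊎_; inj₁; inj₂)
open import Data.Vec.Functional using (Vector)
open import Function.Base using (_∘_)
open import Function.Bundles using (Inverse; _⇔_; mk⇔; Equivalence)
open import Function.Construct.Composition using (_⇔-∘_)
open import Level using (Level; _⊔_)
open import Relation.Binary.PropositionalEquality as ≡ using (_≡_; _≢_)
import Relation.Binary.Reasoning.Setoid as SetoidReasoning
open import Relation.Nullary using (Dec; yes; no; ¬_; contradiction)
open import Relation.Nullary.Decidable using (map′; decidable-stable)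
open import Relation.Unary using (Pred; Decidable; _∩_; _⊆_; Satisfiable)
open import Relation.Unary.Properties using (≐-refl)

private
  variable
    a b p : Level
    A B : Set a
    m n : ℕ

-- Finite sums of natural numbers

module ℕΣ = SemiringSum ℕ.+-*-semiring

-- Opaque, because the summands could not be inferred from an unfolded sum.
opaque
  ∑ : Vector A n → (A → ℕ) → ℕ
  ∑ xs f = ℕΣ.sum (f ∘ xs)

syntax ∑ xs (λ x → e) = ∑[ x ∈ xs ] e

opaque
  unfolding ∑

  ∑-cong′ : (xs : Vector A n) {f g : A → ℕ} → (∀ i → f (xs i) ≡ g (xs i)) → ∑ xs f ≡ ∑ xs g
  ∑-cong′ xs f≗g = ℕΣ.sum-cong-≗ f≗g

  ∑-mono′ : (xs : Vector A n) {f g : A → ℕ} → (∀ i → f (xs i) ≤ g (xs i)) → ∑ xs f ≤ ∑ xs g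
  ∑-mono′ {n = zero}  xs         f≤g = z≤n
  ∑-mono′ {n = suc n} xs {f} {g} f≤g =
    ℕ.+-mono-≤ (f≤g zero) (∑-mono′ (xs ∘ suc) {f} {g} (f≤g ∘ suc))

  ∑-const : (xs : Vector A n) (k : ℕ) → ∑[ _ ∈ xs ] k ≡ n ℕ.* k
  ∑-const {n = zero}  xs k = ≡.refl
  ∑-const {n = suc n} xs k = ≡.cong (k ℕ.+_) (∑-const (xs ∘ suc) k)

  ∑-+ : (xs : Vector A n) (f g : A → ℕ) → ∑[ x ∈ xs ] (f x ℕ.+ g x) ≡ ∑ xs f ℕ.+ ∑ xs g
  ∑-+ xs f g = ℕΣ.∑-distrib-+ (f ∘ xs) (g ∘ xs)

  ∑-*ˡ : (xs : Vector A n) (k : ℕ) (f : A → ℕ) → ∑[ x ∈ xs ] (k ℕ.* f x) ≡ k ℕ.* ∑ xs f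
  ∑-*ˡ xs k f = ≡.sym (ℕΣ.*-distribˡ-sum k (f ∘ xs))

  ∑-*ʳ : (xs : Vector A n) (k : ℕ) (f : A → ℕ) → ∑[ x ∈ xs ] (f x ℕ.* k) ≡ ∑ xs f ℕ.* k
  ∑-*ʳ xs k f = ≡.sym (ℕΣ.*-distribʳ-sum k (f ∘ xs))

  ∑-swap : (xs : Vector A m) (ys : Vector B n) (f : A → B → ℕ) →
           ∑[ x ∈ xs ] ∑[ y ∈ ys ] f x y ≡ ∑[ y ∈ ys ] ∑[ x ∈ xs ] f x y
  ∑-swap xs ys f = ℕΣ.∑-comm (λ i j → f (xs i) (ys j))

  ∑-remove : (xs : Vector A (suc n)) (i : Fin (suc n)) (f : A → ℕ) →
             ∑ xs f ≡ f (xs i) ℕ.+ ∑ (xs ∘ punchIn i) f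
  ∑-remove xs i f = ℕΣ.sum-remove {i = i} (f ∘ xs)

∑-cong : (xs : Vector A n) {f g : A → ℕ} → (∀ x → f x ≡ g x) → ∑ xs f ≡ ∑ xs g
∑-cong xs f≗g = ∑-cong′ xs (f≗g ∘ xs)

∑-mono : (xs : Vector A n) {f g : A → ℕ} → (∀ x → f x ≤ g x) → ∑ xs f ≤ ∑ xs g
∑-mono xs f≤g = ∑-mono′ xs (f≤g ∘ xs)

∑-zero : (xs : Vector A n) {f : A → ℕ} → (∀ i → f (xs i) ≡ 0) → ∑ xs f ≡ 0
∑-zero {n = n} xs f≡0 = ℕ.n≤0⇒n≡0 (ℕ.≤-trans (∑-mono′ xs (ℕ.≤-reflexive ∘ f≡0))
  (ℕ.≤-reflexive (≡.trans (∑-const xs 0) (ℕ.*-zeroʳ n))))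

∑-swap² : ∀ {k l} {C : Set a} {D : Set b} (xs : Vector A m) (ys : Vector B n)
          (zs : Vector C k) (ws : Vector D l) (f : A → B → C → D → ℕ) →
          ∑[ x ∈ xs ] ∑[ y ∈ ys ] ∑[ z ∈ zs ] ∑[ w ∈ ws ] f x y z w
          ≡ ∑[ z ∈ zs ] ∑[ w ∈ ws ] ∑[ x ∈ xs ] ∑[ y ∈ ys ] f x y z w
∑-swap² xs ys zs ws f = begin
  ∑[ x ∈ xs ] ∑[ y ∈ ys ] ∑[ z ∈ zs ] ∑[ w ∈ ws ] f x y z w
    ≡⟨ ∑-cong xs (λ x → ∑-swap ys zs _) ⟩
  ∑[ x ∈ xs ] ∑[ z ∈ zs ] ∑[ y ∈ ys ] ∑[ w ∈ ws ] f x y z w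
    ≡⟨ ∑-swap xs zs _ ⟩
  ∑[ z ∈ zs ] ∑[ x ∈ xs ] ∑[ y ∈ ys ] ∑[ w ∈ ws ] f x y z w
    ≡⟨ ∑-cong zs (λ z → ∑-cong xs (λ x → ∑-swap ys ws _)) ⟩
  ∑[ z ∈ zs ] ∑[ x ∈ xs ] ∑[ w ∈ ws ] ∑[ y ∈ ys ] f x y z w
    ≡⟨ ∑-cong zs (λ z → ∑-swap xs ws _) ⟩
  ∑[ z ∈ zs ] ∑[ w ∈ ws ] ∑[ x ∈ xs ] ∑[ y ∈ ys ] f x y z w ∎
  where open ≡.≡-Reasoning

∑-product : (xs : Vector A m) (ys : Vector B n) (f : A → ℕ) (g : B → ℕ) →
            ∑[ x ∈ xs ] ∑[ y ∈ ys ] (f x ℕ.* g y) ≡ ∑ xs f ℕ.* ∑ ys g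
∑-product xs ys f g = ≡.trans (∑-cong xs (λ x → ∑-*ˡ ys (f x) g)) (∑-*ʳ xs (∑ ys g) f)

-- Indicator functions of decidable predicates.

𝟙 : {P : Set p} → Dec P → ℕ
𝟙 (yes _) = 1
𝟙 (no  _) = 0

module _ {P : Set p} where

  𝟙-yes : (P? : Dec P) → P → 𝟙 P? ≡ 1
  𝟙-yes (yes _) _ = ≡.refl
  𝟙-yes (no ¬p) p = contradiction p ¬p

  𝟙-no : (P? : Dec P) → ¬ P → 𝟙 P? ≡ 0
  𝟙-no (yes p) ¬p = contradiction p ¬p
  𝟙-no (no  _) _  = ≡.refl

  𝟙-bound : ∀ {k} (P? : Dec P) → (P → 1 ≤ k) → 𝟙 P? ≤ k
  𝟙-bound (yes p) h = h p
  𝟙-bound (no  _) h = z≤n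

  1≤𝟙 : (P? : Dec P) → P → 1 ≤ 𝟙 P?
  1≤𝟙 P? p = ℕ.≤-reflexive (≡.sym (𝟙-yes P? p))

𝟙-cong : {P : Set p} {R : Set b} (P? : Dec P) (R? : Dec R) → (P → R) → (R → P) → 𝟙 P? ≡ 𝟙 R?
𝟙-cong P? (yes r) P→R R→P = 𝟙-yes P? (R→P r)
𝟙-cong P? (no ¬r) P→R R→P = 𝟙-no P? (¬r ∘ P→R)

𝟙-*-bound : ∀ {k} {P : Set p} {R : Set b} (P? : Dec P) (R? : Dec R) →
            (P → R → 1 ≤ k) → 𝟙 P? ℕ.* 𝟙 R? ≤ k
𝟙-*-bound (yes p) R? h = ℕ.≤-trans (ℕ.≤-reflexive (ℕ.*-identityˡ _)) (𝟙-bound R? (h p))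
𝟙-*-bound (no  _) R? h = z≤n

module _ {P : Pred A p} (P? : Decidable P) where

  -- Lets a bound on a count start from one concrete solution, the empty case being trivial.
  ∑𝟙-witness : (xs : Vector A n) → (∑[ x ∈ xs ] 𝟙 (P? x) ≡ 0) ⊎ ∃[ i ] P (xs i)
  ∑𝟙-witness {n = n} xs with Fin.any? (P? ∘ xs)
  ... | yes (i , pi) = inj₂ (i , pi)
  ... | no  ¬p = inj₁ (∑-zero xs (λ i → 𝟙-no (P? (xs i)) (λ pi → ¬p (i , pi))))

-- Numerical inequalities for the variance argument.

2mn≤m²+n² : ∀ m n → 2 ℕ.* (m ℕ.* n) ≤ m ℕ.* m ℕ.+ n ℕ.* n
2mn≤m²+n² m n = case (ℕ.≤-total m n)
  where
  square : ∀ m k → 2 ℕ.* (m ℕ.* (m ℕ.+ k)) ℕ.+ k ℕ.* k ≡ m ℕ.* m ℕ.+ (m ℕ.+ k) ℕ.* (m ℕ.+ k)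
  square = solve-∀
  ordered : ∀ {m n} → m ≤ n → 2 ℕ.* (m ℕ.* n) ≤ m ℕ.* m ℕ.+ n ℕ.* n
  ordered {m} m≤n with k , ≡.refl ← ℕ.m≤n⇒∃[o]m+o≡n m≤n =
    ≡.subst (2 ℕ.* (m ℕ.* (m ℕ.+ k)) ≤_) (square m k) (ℕ.m≤m+n _ (k ℕ.* k))
  case : m ≤ n ⊎ n ≤ m → 2 ℕ.* (m ℕ.* n) ≤ m ℕ.* m ℕ.+ n ℕ.* n
  case (inj₁ m≤n) = ordered m≤n
  case (inj₂ n≤m) = ≡.subst₂ _≤_ (≡.cong (2 ℕ.*_) (ℕ.*-comm n m)) (ℕ.+-comm (n ℕ.* n) (m ℕ.* m)) (ordered n≤m)

-- This contradicts variance-bound below: N is the number of units, C = A B.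
variance-large : ∀ C N → (C ℕ.+ 3) ℕ.* (C ℕ.+ 3) ≤ suc N → let μ = ℕ.pred N in
  C ℕ.* (N ℕ.* (N ℕ.* (N ℕ.* N ℕ.+ suc N ℕ.* C))) ℕ.+ C ℕ.* (suc N ℕ.* (suc N ℕ.* (μ ℕ.* μ)))
  < 2 ℕ.* C ℕ.* μ ℕ.* (N ℕ.* (N ℕ.* suc N)) ℕ.+ μ ℕ.* μ ℕ.* (N ℕ.* N)
variance-large C N large with d , eq ← ℕ.m≤n⇒∃[o]m+o≡n large =
  ≡.subst (λ N → let μ = ℕ.pred N in
      C ℕ.* (N ℕ.* (N ℕ.* (N ℕ.* N ℕ.+ suc N ℕ.* C))) ℕ.+ C ℕ.* (suc N ℕ.* (suc N ℕ.* (μ ℕ.* μ)))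
      < 2 ℕ.* C ℕ.* μ ℕ.* (N ℕ.* (N ℕ.* suc N)) ℕ.+ μ ℕ.* μ ℕ.* (N ℕ.* N))
    (ℕ.suc-injective (≡.trans (≡.sym (size C d)) eq)) (explicit C d)
  where
  open ℕ.≤-Reasoning
  -- `d` is the slack in (C + 3)² + d = N + 1, so N = μ + 1 with μ = C² + 6C + 7 + d.
  size : ∀ C d → (C ℕ.+ 3) ℕ.* (C ℕ.+ 3) ℕ.+ d ≡ suc (suc (C ℕ.* C ℕ.+ 6 ℕ.* C ℕ.+ 7 ℕ.+ d))
  size = solve-∀
  lhs : ∀ C μ →
    2 ℕ.* C ℕ.* μ ℕ.* (suc μ ℕ.* (suc μ ℕ.* suc (suc μ))) ℕ.+ μ ℕ.* μ ℕ.* (suc μ ℕ.* suc μ)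
    ≡ 2 ℕ.* C ℕ.* μ ℕ.* (suc μ ℕ.* (suc μ ℕ.* suc (suc μ))) ℕ.+ suc μ ℕ.* suc μ ℕ.* (μ ℕ.* μ)
  lhs = solve-∀
  -- Since N² = μ(μ + 2) + 1, the sum N⁴ + (μ(μ + 2))² exceeds 2N²μ(μ + 2) by exactly 1. Removing
  -- the common term thus leaves C + (μ + 2)N²C² against N²μ².
  rhs : ∀ C μ →
    C ℕ.* (suc μ ℕ.* (suc μ ℕ.* (suc μ ℕ.* suc μ ℕ.+ suc (suc μ) ℕ.* C)))
      ℕ.+ C ℕ.* (suc (suc μ) ℕ.* (suc (suc μ) ℕ.* (μ ℕ.* μ)))
    ≡ 2 ℕ.* C ℕ.* μ ℕ.* (suc μ ℕ.* (suc μ ℕ.* suc (suc μ)))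
      ℕ.+ (C ℕ.+ (μ ℕ.+ 2) ℕ.* (suc μ ℕ.* suc μ) ℕ.* (C ℕ.* C))
  rhs = solve-∀
  factor : ∀ C μ M → M ℕ.* C ℕ.+ (μ ℕ.+ 2) ℕ.* M ℕ.* (C ℕ.* C) ≡ M ℕ.* (C ℕ.+ (μ ℕ.+ 2) ℕ.* (C ℕ.* C))
  factor = solve-∀
  -- Once `C` is enlarged to N²C and N² is divided out, C + (μ + 2)C² < μ² remains; the second
  -- summand is the explicit surplus.
  gap : ∀ C d → let μ = C ℕ.* C ℕ.+ 6 ℕ.* C ℕ.+ 7 ℕ.+ d in
    suc (C ℕ.+ (μ ℕ.+ 2) ℕ.* (C ℕ.* C))
      ℕ.+ (6 ℕ.* C ℕ.* C ℕ.* C ℕ.+ 41 ℕ.* C ℕ.* C ℕ.+ 83 ℕ.* C ℕ.+ 48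
           ℕ.+ d ℕ.* C ℕ.* C ℕ.+ 12 ℕ.* C ℕ.* d ℕ.+ 14 ℕ.* d ℕ.+ d ℕ.* d)
    ≡ μ ℕ.* μ
  gap = solve-∀
  explicit : ∀ C d → let μ = C ℕ.* C ℕ.+ 6 ℕ.* C ℕ.+ 7 ℕ.+ d ; N = suc μ in
    C ℕ.* (N ℕ.* (N ℕ.* (N ℕ.* N ℕ.+ suc N ℕ.* C))) ℕ.+ C ℕ.* (suc N ℕ.* (suc N ℕ.* (μ ℕ.* μ)))
    < 2 ℕ.* C ℕ.* μ ℕ.* (N ℕ.* (N ℕ.* suc N)) ℕ.+ μ ℕ.* μ ℕ.* (N ℕ.* N)
  explicit C d =
    ≡.subst₂ _<_ (≡.sym (rhs C μ)) (≡.sym (lhs C μ)) (ℕ.+-monoʳ-< common (begin-strict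
      C ℕ.+ (μ ℕ.+ 2) ℕ.* M ℕ.* (C ℕ.* C)
        ≤⟨ ℕ.+-monoˡ-≤ _ (ℕ.m≤n*m C M) ⟩
      M ℕ.* C ℕ.+ (μ ℕ.+ 2) ℕ.* M ℕ.* (C ℕ.* C)
        ≡⟨ factor C μ M ⟩
      M ℕ.* (C ℕ.+ (μ ℕ.+ 2) ℕ.* (C ℕ.* C))
        <⟨ ℕ.*-monoʳ-< M (≡.subst (suc (C ℕ.+ (μ ℕ.+ 2) ℕ.* (C ℕ.* C)) ≤_) (gap C d) (ℕ.m≤m+n _ _)) ⟩
      M ℕ.* (μ ℕ.* μ)
        ∎))
    where
    μ = C ℕ.* C ℕ.+ 6 ℕ.* C ℕ.+ 7 ℕ.+ d
    M = suc μ ℕ.* suc μ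
    common = 2 ℕ.* C ℕ.* μ ℕ.* (suc μ ℕ.* (suc μ ℕ.* suc (suc μ)))

-- Counting in a finite field

module Finite {N c ℓ} (F : FiniteField (suc N) c ℓ) where
  open FiniteField F hiding (_^_; zero)
  open Exp commutativeSemiring public using (_^_; ^-congˡ; ^-congʳ; ^-homo-*; ^-assocʳ; ^-distrib-*)
  open RingSolver commutativeSemiring using (solve; _:=_; _:+_; _:*_)
  open GroupProperties +-group using () renaming (∙-cancelˡ to +-cancelˡ; ∙-cancelʳ to +-cancelʳ)
  open SetoidReasoning setoid
  module E = Inverse enumeration

  infix 4 _≟_
  _≟_ : ∀ x y → Dec (x ≈ y)
  x ≟ y = map′ (λ eq → trans (sym (E.strictlyInverseʳ x)) (trans (E.from-cong eq) (E.strictlyInverseʳ y)))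
               E.to-cong (E.to x Fin.≟ E.to y)

  _⁻¹ : ∀ {x} → x ≉ 0# → Carrier
  x≉0 ⁻¹ = proj₁ (invertible x≉0)

  ⁻¹-inverseˡ : ∀ {x} (x≉0 : x ≉ 0#) → x≉0 ⁻¹ * x ≈ 1#
  ⁻¹-inverseˡ x≉0 = proj₁ (proj₂ (invertible x≉0))

  ⁻¹-inverseʳ : ∀ {x} (x≉0 : x ≉ 0#) → x * x≉0 ⁻¹ ≈ 1#
  ⁻¹-inverseʳ x≉0 = proj₂ (proj₂ (invertible x≉0))

  *-cancelˡ : ∀ {x y z} → x ≉ 0# → x * y ≈ x * z → y ≈ z
  *-cancelˡ {x} {y} {z} x≉0 eq = begin
    y                  ≈⟨ lemma y ⟨
    x≉0 ⁻¹ * (x * y)   ≈⟨ *-congˡ eq ⟩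
    x≉0 ⁻¹ * (x * z)   ≈⟨ lemma z ⟩
    z                  ∎
    where
    lemma : ∀ w → x≉0 ⁻¹ * (x * w) ≈ w
    lemma w = trans (sym (*-assoc _ _ _)) (trans (*-congʳ (⁻¹-inverseˡ x≉0)) (*-identityˡ w))

  *-cancelʳ : ∀ {x y z} → x ≉ 0# → y * x ≈ z * x → y ≈ z
  *-cancelʳ x≉0 eq = *-cancelˡ x≉0 (trans (*-comm _ _) (trans eq (*-comm _ _)))

  *-≉0 : ∀ {x y} → x ≉ 0# → y ≉ 0# → x * y ≉ 0#
  *-≉0 x≉0 y≉0 xy≈0 = y≉0 (*-cancelˡ x≉0 (trans xy≈0 (sym (zeroʳ _))))

  *-≉0ˡ : ∀ {x y} → x * y ≉ 0# → x ≉ 0#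
  *-≉0ˡ xy≉0 x≈0 = xy≉0 (trans (*-congʳ x≈0) (zeroˡ _))

  ⁻¹-≉0 : ∀ {x} (x≉0 : x ≉ 0#) → x≉0 ⁻¹ ≉ 0#
  ⁻¹-≉0 x≉0 = *-≉0ˡ (λ eq → 1≉0 (trans (sym (⁻¹-inverseˡ x≉0)) eq))

  ^-≉0 : ∀ {x} n → x ≉ 0# → x ^ n ≉ 0#
  ^-≉0 zero    x≉0 = 1≉0
  ^-≉0 (suc n) x≉0 = *-≉0 x≉0 (^-≉0 n x≉0)

  1^n≈1 : ∀ n → 1# ^ n ≈ 1#
  1^n≈1 zero    = refl
  1^n≈1 (suc n) = trans (*-identityˡ _) (1^n≈1 n)

  all : Vector Carrier (suc N)
  all = E.from

  units : Vector Carrier N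
  units j = all (punchIn (E.to 0#) j)

  units-≉0 : ∀ j → units j ≉ 0#
  units-≉0 j eq = Fin.punchInᵢ≢i (E.to 0#) j
    (≡.trans (≡.sym (E.strictlyInverseˡ _)) (E.to-cong eq))

  units-surjective : ∀ {x} → x ≉ 0# → ∃[ j ] units j ≈ x
  units-surjective {x} x≉0 =
    punchOut 0≢x , trans (E.from-cong (Fin.punchIn-punchOut 0≢x)) (E.strictlyInverseʳ x)
    where
    0≢x : E.to 0# ≡.≢ E.to x
    0≢x eq = x≉0 (trans (sym (E.strictlyInverseʳ x)) (trans (E.from-cong (≡.sym eq)) (E.strictlyInverseʳ 0#)))

  ∑-units≤all : (f : Carrier → ℕ) → ∑ units f ≤ ∑ all f
  ∑-units≤all f = ℕ.≤-trans (ℕ.m≤n+m _ _) (ℕ.≤-reflexive (≡.sym (∑-remove all (E.to 0#) f)))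

  ∑-single : ∀ y → ∑[ x ∈ all ] 𝟙 (x ≟ y) ≡ 1
  ∑-single y = ≡.trans (∑-remove all (E.to y) (λ x → 𝟙 (x ≟ y)))
    (≡.cong₂ ℕ._+_ (𝟙-yes (_ ≟ y) (E.strictlyInverseʳ y))
      (∑-zero (all ∘ punchIn (E.to y)) (λ j → 𝟙-no (_ ≟ y) (λ eq → Fin.punchInᵢ≢i (E.to y) j
        (≡.trans (≡.sym (E.strictlyInverseˡ _)) (E.to-cong eq))))))

  -- The complete homogeneous symmetric polynomials are the iterated divided
  -- differences of the powers, which gives the bound on the number of roots.
  hsym : ℕ → List Carrier → Carrier
  hsym zero    xs       = 1#
  hsym (suc k) []       = 0#
  hsym (suc k) (x ∷ xs) = x * hsym k (x ∷ xs) + hsym (suc k) xs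

  -- Subtraction-free form of the divided difference h_(k+1)(x, xs) - h_(k+1)(y, xs) = (x - y)
  -- h_k(x, y, xs).
  hsym-difference : ∀ k x y xs →
    hsym (suc k) (x ∷ xs) + y * hsym k (x ∷ y ∷ xs) ≈ hsym (suc k) (y ∷ xs) + x * hsym k (x ∷ y ∷ xs)
  hsym-difference zero x y xs =
    solve 4 (λ x y r o → (x :* o :+ r) :+ y :* o := (y :* o :+ r) :+ x :* o) refl x y (hsym 1 xs) 1#
  hsym-difference (suc k) x y xs = begin
    (x * u + r) + y * (x * w + (y * v + t))
      ≈⟨ solve 7 (λ x y u v w r t → (x :* u :+ r) :+ y :* (x :* w :+ (y :* v :+ t))
          := x :* (u :+ y :* w) :+ (r :+ y :* (y :* v :+ t))) refl x y u v w r t ⟩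
    x * (u + y * w) + (r + y * (y * v + t))
      ≈⟨ +-congʳ (*-congˡ (hsym-difference k x y xs)) ⟩
    x * ((y * v + t) + x * w) + (r + y * (y * v + t))
      ≈⟨ solve 6 (λ x y v w r t → x :* ((y :* v :+ t) :+ x :* w) :+ (r :+ y :* (y :* v :+ t))
          := (y :* (y :* v :+ t) :+ r) :+ x :* (x :* w :+ (y :* v :+ t))) refl x y v w r t ⟩
    (y * (y * v + t) + r) + x * (x * w + (y * v + t)) ∎
    where
    u = hsym (suc k) (x ∷ xs)
    v = hsym k (y ∷ xs)
    w = hsym k (x ∷ y ∷ xs)
    t = hsym (suc k) xs
    r = hsym (suc (suc k)) xs

  -- Induction on the degree: fix a root z. By `hsym-difference`, every other root x is a zero of
  -- the polynomial of degree one less with z added to `xs`. So `xs` collects the roots already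
  -- split off, and `d` is 0 from the second round on.
  hsym-roots : ∀ k xs d → ∑[ x ∈ all ] 𝟙 (hsym (suc k) (x ∷ xs) ≟ d) ≤ suc k
  hsym-roots k xs d with ∑𝟙-witness (λ x → hsym (suc k) (x ∷ xs) ≟ d) all
  ... | inj₁ none = ≡.subst (_≤ suc k) (≡.sym none) z≤n
  ... | inj₂ (i , z-root) = bound k z-root
    where
    z = all i
    second-root : ∀ k {x} → hsym (suc k) (z ∷ xs) ≈ d → x ≉ z → hsym (suc k) (x ∷ xs) ≈ d →
                  hsym k (x ∷ z ∷ xs) ≈ 0#
    -- Equality is decidable, so it suffices to refute a nonzero value: cancelling it would give x ≈
    -- z.
    second-root k {x} hz x≉z hx = decidable-stable (hsym k (x ∷ z ∷ xs) ≟ 0#) λ h≉0 →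
      x≉z (*-cancelʳ h≉0 (+-cancelˡ d _ _ (begin
        d + x * hsym k (x ∷ z ∷ xs)                      ≈⟨ +-congʳ hz ⟨
        hsym (suc k) (z ∷ xs) + x * hsym k (x ∷ z ∷ xs)  ≈⟨ hsym-difference k x z xs ⟨
        hsym (suc k) (x ∷ xs) + z * hsym k (x ∷ z ∷ xs)  ≈⟨ +-congʳ hx ⟩
        d + z * hsym k (x ∷ z ∷ xs)                      ∎)))
    pointwise : ∀ k → hsym (suc k) (z ∷ xs) ≈ d → ∀ x →
      𝟙 (hsym (suc k) (x ∷ xs) ≟ d) ≤ 𝟙 (x ≟ z) ℕ.+ 𝟙 (hsym k (x ∷ z ∷ xs) ≟ 0#)
    pointwise k hz x = 𝟙-bound (hsym (suc k) (x ∷ xs) ≟ d) λ hx → case-≟ hx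
      where
      case-≟ : hsym (suc k) (x ∷ xs) ≈ d → 1 ≤ 𝟙 (x ≟ z) ℕ.+ 𝟙 (hsym k (x ∷ z ∷ xs) ≟ 0#)
      case-≟ hx with x ≟ z
      ... | yes _   = s≤s z≤n
      ... | no  x≉z = 1≤𝟙 (_ ≟ 0#) (second-root k hz x≉z hx)
    rest : ∀ k → ∑[ x ∈ all ] 𝟙 (hsym k (x ∷ z ∷ xs) ≟ 0#) ≤ k
    -- In degree 0 the polynomial is the constant 1, which has no zeros.
    rest zero    = ℕ.≤-reflexive (∑-zero all (λ _ → 𝟙-no (1# ≟ 0#) 1≉0))
    rest (suc k) = hsym-roots k (z ∷ xs) 0#
    bound : ∀ k → hsym (suc k) (z ∷ xs) ≈ d → ∑[ x ∈ all ] 𝟙 (hsym (suc k) (x ∷ xs) ≟ d) ≤ suc k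
    bound k hz = ℕ.≤-trans (∑-mono all (pointwise k hz))
      (ℕ.≤-trans (ℕ.≤-reflexive (∑-+ all _ _))
        (ℕ.+-mono-≤ (ℕ.≤-reflexive (∑-single z)) (rest k)))

  hsym-singleton : ∀ k x → hsym k (x ∷ []) ≈ x ^ k
  hsym-singleton zero    x = refl
  hsym-singleton (suc k) x = trans (+-identityʳ _) (*-congˡ (hsym-singleton k x))

  power-roots : ∀ {k} → 1 ≤ k → ∀ d → ∑[ x ∈ all ] 𝟙 (x ^ k ≟ d) ≤ k
  power-roots {suc k} _ d = ℕ.≤-trans
    (∑-mono all λ x → 𝟙-bound (x ^ suc k ≟ d) λ eq →
      1≤𝟙 (hsym (suc k) (x ∷ []) ≟ d) (trans (hsym-singleton (suc k) x) eq))
    (hsym-roots k [] d)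

  -- Fermat's little theorem.

  open MonoidSum *-commutativeMonoid using () renaming
    (sum to ∏; sum-permute to ∏-permute; sum-cong-≋ to ∏-cong;
     ∑-distrib-+ to ∏-distrib; sum-replicate to ∏-replicate)

  ∏-≉0 : ∀ {m} (f : Vector Carrier m) → (∀ i → f i ≉ 0#) → ∏ f ≉ 0#
  ∏-≉0 {zero}  f f≉0 = 1≉0
  ∏-≉0 {suc m} f f≉0 = *-≉0 (f≉0 zero) (∏-≉0 (f ∘ suc) (f≉0 ∘ suc))

  ∏-const : ∀ m x → ∏ {m} (λ _ → x) ≈ x ^ m
  ∏-const m x = ∏-replicate m

  module _ {x} (x≉0 : x ≉ 0#) where

    scale : Permutation N N
    scale = Perm.permutation to from to∘from from∘to
      where
      to from : Fin N → Fin N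
      to   j = proj₁ (units-surjective (*-≉0 x≉0 (units-≉0 j)))
      from j = proj₁ (units-surjective (*-≉0 (⁻¹-≉0 x≉0) (units-≉0 j)))
      injective : ∀ {i j} → units i ≈ units j → i ≡ j
      injective eq = Fin.punchIn-injective (E.to 0#) _ _
        (≡.trans (≡.sym (E.strictlyInverseˡ _)) (≡.trans (E.to-cong eq) (E.strictlyInverseˡ _)))
      round-trip : ∀ {y z} → y * z ≈ 1# → ∀ {u v w} → u ≈ y * v → v ≈ z * w → u ≈ w
      round-trip {y} {z} yz≈1 {u} {v} {w} u≈ v≈ = begin
        u           ≈⟨ u≈ ⟩
        y * v       ≈⟨ *-congˡ v≈ ⟩
        y * (z * w) ≈⟨ *-assoc _ _ _ ⟨
        y * z * w   ≈⟨ *-congʳ yz≈1 ⟩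
        1# * w      ≈⟨ *-identityˡ w ⟩
        w           ∎
      x*units : ∀ j → units (to j) ≈ x * units j
      x*units j = proj₂ (units-surjective (*-≉0 x≉0 (units-≉0 j)))
      x⁻¹*units : ∀ j → units (from j) ≈ x≉0 ⁻¹ * units j
      x⁻¹*units j = proj₂ (units-surjective (*-≉0 (⁻¹-≉0 x≉0) (units-≉0 j)))
      to∘from : ∀ j → to (from j) ≡ j
      to∘from j = injective (round-trip (⁻¹-inverseʳ x≉0) (x*units (from j)) (x⁻¹*units j))
      from∘to : ∀ j → from (to j) ≡ j
      from∘to j = injective (round-trip (⁻¹-inverseˡ x≉0) (x⁻¹*units (to j)) (x*units j))

    -- Multiplication by x permutes the units, so their product equals x^N times itself; being
    -- nonzero, it cancels.
    fermat : x ^ N ≈ 1#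
    fermat = *-cancelʳ (∏-≉0 units units-≉0) (begin
      x ^ N * ∏ units                 ≈⟨ *-congʳ (∏-const N x) ⟨
      ∏ {N} (λ _ → x) * ∏ units       ≈⟨ ∏-distrib (λ _ → x) units ⟨
      ∏ (λ j → x * units j)           ≈⟨ ∏-cong (λ j → sym (proj₂ (units-surjective (*-≉0 x≉0 (units-≉0 j))))) ⟩
      ∏ (λ j → units (scale ⟨$⟩ʳ j))  ≈⟨ ∏-permute units scale ⟨
      ∏ units                         ≈⟨ *-identityˡ _ ⟨
      1# * ∏ units                    ∎)

  -- Fibres of the power maps.

  fibre : ℕ → Carrier → Carrier → ℕ
  fibre k u y = ∑[ z ∈ units ] 𝟙 (y ≟ u * z ^ k)

  ∑-fibre : ∀ k u → ∑ all (fibre k u) ≡ N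
  ∑-fibre k u = ≡.trans (∑-swap all units _)
    (≡.trans (∑-cong units (λ z → ∑-single (u * z ^ k))) (≡.trans (∑-const units 1) (ℕ.*-identityʳ N)))

  -- Dividing by u turns the fibre into a set of roots of z^k = y / u.
  fibre-≤ : ∀ {k} → 1 ≤ k → ∀ {u} → u ≉ 0# → ∀ y → fibre k u y ≤ k
  fibre-≤ {k} 1≤k {u} u≉0 y = ℕ.≤-trans (∑-units≤all _) (ℕ.≤-trans
    (∑-mono all λ z → 𝟙-bound (y ≟ u * z ^ k) λ eq → 1≤𝟙 (z ^ k ≟ u≉0 ⁻¹ * y) (*-cancelˡ u≉0 (begin
      u * z ^ k            ≈⟨ eq ⟨
      y                    ≈⟨ *-identityˡ y ⟨
      1# * y               ≈⟨ *-congʳ (⁻¹-inverseʳ u≉0) ⟨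
      u * u≉0 ⁻¹ * y       ≈⟨ *-assoc _ _ _ ⟩
      u * (u≉0 ⁻¹ * y)     ∎)))
    (power-roots 1≤k (u≉0 ⁻¹ * y)))

  fibre-empty : ∀ k u y → (∀ {z} → z ≉ 0# → y ≉ u * z ^ k) → fibre k u y ≡ 0
  fibre-empty k u y none = ∑-zero units (λ j → 𝟙-no (y ≟ _) (none (units-≉0 j)))

  -- If c were not a d-th power, then the fibres of z ↦ z ^ d, of size at most d,
  -- over fewer than m roots of y ^ m = 1 could not cover all d * m units.
  isPower : ∀ {d m c} → 1 ≤ d → d ℕ.* m ≡ N → 1 ≤ m → c ^ m ≈ 1# → ∃[ z ] z ≉ 0# × c ≈ z ^ d
  isPower {d} {m} {c} 1≤d dm≡N 1≤m c^m≈1 with Fin.any? (λ j → c ≟ units j ^ d)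
  ... | yes (j , eq) = units j , units-≉0 j , eq
  ... | no  ¬power   = contradiction too-many (ℕ.<⇒≱ (ℕ.m<m+n N 1≤d))
    where
    not-power : ∀ {z} → z ≉ 0# → c ≉ z ^ d
    not-power z≉0 eq with j , eqⱼ ← units-surjective z≉0 = ¬power (j , trans eq (^-congˡ d (sym eqⱼ)))
    root : ∀ {y z} → z ≉ 0# → y ≈ 1# * z ^ d → y ^ m ≈ 1#
    root {y} {z} z≉0 eq = begin
      y ^ m          ≈⟨ ^-congˡ m (trans eq (*-identityˡ _)) ⟩
      (z ^ d) ^ m    ≈⟨ ^-assocʳ z d m ⟩
      z ^ (d ℕ.* m)  ≈⟨ ^-congʳ z dm≡N ⟩
      z ^ N          ≈⟨ fermat z≉0 ⟩
      1#             ∎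
    -- At y = c the fibre is empty although y^m = 1, which leaves room for an extra `d`; summing
    -- over y then gives N + d ≤ d m = N.
    pointwise : ∀ y → fibre d 1# y ℕ.+ d ℕ.* 𝟙 (y ≟ c) ≤ d ℕ.* 𝟙 (y ^ m ≟ 1#)
    pointwise y with y ≟ c | y ^ m ≟ 1#
    ... | yes y≈c | yes _    = ℕ.+-monoˡ-≤ (d ℕ.* 1) (ℕ.≤-reflexive
      (fibre-empty d 1# y (λ z≉0 eq → not-power z≉0 (trans (sym y≈c) (trans eq (*-identityˡ _))))))
    ... | yes y≈c | no  y^m≉1 = contradiction (trans (^-congˡ m y≈c) c^m≈1) y^m≉1
    ... | no  _   | yes _    = ℕ.≤-trans
      (ℕ.+-mono-≤ (fibre-≤ 1≤d 1≉0 y) (ℕ.≤-reflexive (ℕ.*-zeroʳ d)))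
      (ℕ.≤-reflexive (≡.trans (ℕ.+-identityʳ d) (≡.sym (ℕ.*-identityʳ d))))
    ... | no  _   | no y^m≉1 = ℕ.≤-reflexive (≡.cong (ℕ._+ d ℕ.* 0)
      (fibre-empty d 1# y (λ z≉0 eq → y^m≉1 (root z≉0 eq))))
    too-many : N ℕ.+ d ≤ N
    too-many = ℕR.begin
      N ℕ.+ d
        ℕR.≡⟨ ≡.cong₂ ℕ._+_ (∑-fibre d 1#) (≡.trans (≡.cong (d ℕ.*_) (∑-single c)) (ℕ.*-identityʳ d)) ⟨
      ∑ all (fibre d 1#) ℕ.+ d ℕ.* ∑[ y ∈ all ] 𝟙 (y ≟ c)
        ℕR.≡⟨ ≡.cong (_ ℕ.+_) (∑-*ˡ all d _) ⟨
      ∑ all (fibre d 1#) ℕ.+ ∑[ y ∈ all ] (d ℕ.* 𝟙 (y ≟ c))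
        ℕR.≡⟨ ∑-+ all _ _ ⟨
      ∑[ y ∈ all ] (fibre d 1# y ℕ.+ d ℕ.* 𝟙 (y ≟ c))
        ℕR.≤⟨ ∑-mono all pointwise ⟩
      ∑[ y ∈ all ] (d ℕ.* 𝟙 (y ^ m ≟ 1#))
        ℕR.≡⟨ ∑-*ˡ all d _ ⟩
      d ℕ.* ∑[ y ∈ all ] 𝟙 (y ^ m ≟ 1#)
        ℕR.≤⟨ ℕ.*-monoʳ-≤ d (power-roots 1≤m 1#) ⟩
      d ℕ.* m
        ℕR.≡⟨ dm≡N ⟩
      N ℕR.∎
      where module ℕR = ℕ.≤-Reasoning

  -- Lines s u + t v = 1 in the (s, t)-plane.

  line-points : ∀ {u} v t → u ≉ 0# → ∑[ s ∈ all ] 𝟙 (s * u + t * v ≟ 1#) ≡ 1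
  line-points {u} v t u≉0 = ≡.trans
    (∑-cong all λ s → 𝟙-cong (s * u + t * v ≟ 1#) (s ≟ s₀) (fwd s) (bwd s))
    (∑-single s₀)
    where
    s₀ = (1# - t * v) * u≉0 ⁻¹
    s₀-on : s₀ * u + t * v ≈ 1#
    s₀-on = begin
      (1# - t * v) * u≉0 ⁻¹ * u + t * v    ≈⟨ +-congʳ (*-assoc _ _ _) ⟩
      (1# - t * v) * (u≉0 ⁻¹ * u) + t * v  ≈⟨ +-congʳ (*-congˡ (⁻¹-inverseˡ u≉0)) ⟩
      (1# - t * v) * 1# + t * v            ≈⟨ +-congʳ (*-identityʳ _) ⟩
      (1# - t * v) + t * v                 ≈⟨ +-assoc _ _ _ ⟩
      1# + (- (t * v) + t * v)             ≈⟨ +-congˡ (-‿inverseˡ _) ⟩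
      1# + 0#                              ≈⟨ +-identityʳ 1# ⟩
      1#                                   ∎
    bwd : ∀ s → s ≈ s₀ → s * u + t * v ≈ 1#
    bwd s eq = trans (+-congʳ (*-congʳ eq)) s₀-on
    fwd : ∀ s → s * u + t * v ≈ 1# → s ≈ s₀
    fwd s eq = *-cancelʳ u≉0 (+-cancelʳ (t * v) _ _ (trans eq (sym s₀-on)))

  -- Multiplying the first equation by u′ and the second by u removes s; the result is linear in t.
  eliminate : ∀ {s t u v u′ v′} → s * u + t * v ≈ 1# → s * u′ + t * v′ ≈ 1# →
              u′ + t * (v′ * u) ≈ u + t * (v * u′)
  eliminate {s} {t} {u} {v} {u′} {v′} eq eq′ = begin
    u′ + t * (v′ * u)                    ≈⟨ +-congʳ (trans (*-congʳ eq) (*-identityˡ u′)) ⟨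
    (s * u + t * v) * u′ + t * (v′ * u)  ≈⟨ solve 6 (λ s t u v u′ v′ →
      (s :* u :+ t :* v) :* u′ :+ t :* (v′ :* u) := (s :* u′ :+ t :* v′) :* u :+ t :* (v :* u′)) refl s t u v u′ v′ ⟩
    (s * u′ + t * v′) * u + t * (v * u′) ≈⟨ +-congʳ (trans (*-congʳ eq′) (*-identityˡ u)) ⟩
    u + t * (v * u′)                     ∎

  -- Subtracting the equalities gives (t - t₀) v = (t - t₀) v′. The subtraction is done by adding
  -- one equality to the reverse of the other and cancelling the common sum.
  equal-slopes : ∀ {t t₀ u v u′ v′} → u + t * v ≈ u′ + t * v′ → u + t₀ * v ≈ u′ + t₀ * v′ → t ≉ t₀ → v ≈ v′
  equal-slopes {t} {t₀} {u} {v} {u′} {v′} eq eq₀ t≉t₀ = *-cancelˡ δ≉0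
    (+-cancelˡ (u + t₀ * v + (u′ + t₀ * v′)) _ _ (begin
      u + t₀ * v + (u′ + t₀ * v′) + δ * v
        ≈⟨ solve 6 (λ t₀ δ u v u′ v′ → u :+ t₀ :* v :+ (u′ :+ t₀ :* v′) :+ δ :* v
            := (u :+ (t₀ :+ δ) :* v) :+ (u′ :+ t₀ :* v′)) refl t₀ δ u v u′ v′ ⟩
      (u + (t₀ + δ) * v) + (u′ + t₀ * v′)
        ≈⟨ +-cong (+-congˡ (*-congʳ t₀+δ≈t)) (sym eq₀) ⟩
      (u + t * v) + (u + t₀ * v)
        ≈⟨ +-congʳ eq ⟩
      (u′ + t * v′) + (u + t₀ * v)
        ≈⟨ +-congʳ (+-congˡ (*-congʳ t₀+δ≈t)) ⟨
      (u′ + (t₀ + δ) * v′) + (u + t₀ * v)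
        ≈⟨ solve 6 (λ t₀ δ u v u′ v′ → (u′ :+ (t₀ :+ δ) :* v′) :+ (u :+ t₀ :* v)
            := u :+ t₀ :* v :+ (u′ :+ t₀ :* v′) :+ δ :* v′) refl t₀ δ u v u′ v′ ⟩
      u + t₀ * v + (u′ + t₀ * v′) + δ * v′ ∎))
    where
    δ = t - t₀
    t₀+δ≈t : t₀ + δ ≈ t
    t₀+δ≈t = begin
      t₀ + (t - t₀)   ≈⟨ +-comm _ _ ⟩
      t - t₀ + t₀     ≈⟨ +-assoc _ _ _ ⟩
      t + (- t₀ + t₀) ≈⟨ +-congˡ (-‿inverseˡ t₀) ⟩
      t + 0#          ≈⟨ +-identityʳ t ⟩
      t               ∎
    δ≉0 : δ ≉ 0#
    δ≉0 δ≈0 = t≉t₀ (trans (sym t₀+δ≈t) (trans (+-congˡ δ≈0) (+-identityʳ t₀)))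

  -- On the first line t determines s, so it suffices to count the t satisfying the equation from
  -- `eliminate`. If two different t do, `equal-slopes` identifies the lines, and the term with
  -- `suc N` covers all t.
  line-intersections : ∀ {u v u′ v′} → u ≉ 0# → v ≉ 0# →
    ∑[ s ∈ all ] ∑[ t ∈ all ] (𝟙 (s * u + t * v ≟ 1#) ℕ.* 𝟙 (s * u′ + t * v′ ≟ 1#))
    ≤ 1 ℕ.+ suc N ℕ.* (𝟙 (u′ ≟ u) ℕ.* 𝟙 (v′ ≟ v))
  line-intersections {u} {v} {u′} {v′} u≉0 v≉0 = ℕR.begin
    ∑[ s ∈ all ] ∑[ t ∈ all ] (on s t ℕ.* 𝟙 (s * u′ + t * v′ ≟ 1#))
      ℕR.≤⟨ ∑-mono all (λ s → ∑-mono all (λ t → 𝟙-*-bound (s * u + t * v ≟ 1#) (s * u′ + t * v′ ≟ 1#)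
              (λ eq eq′ → ℕ.*-mono-≤ (1≤𝟙 (_ ≟ 1#) eq) (1≤𝟙 (_ ≟ _) (eliminate eq eq′))))) ⟩
    ∑[ s ∈ all ] ∑[ t ∈ all ] (on s t ℕ.* agree t)
      ℕR.≡⟨ ∑-swap all all _ ⟩
    ∑[ t ∈ all ] ∑[ s ∈ all ] (on s t ℕ.* agree t)
      ℕR.≡⟨ ∑-cong all (λ t → ≡.trans (∑-*ʳ all (agree t) _)
              (≡.trans (≡.cong (ℕ._* agree t) (line-points v t u≉0)) (ℕ.*-identityˡ _))) ⟩
    ∑ all agree
      ℕR.≤⟨ agree-bound ⟩
    1 ℕ.+ suc N ℕ.* same ℕR.∎
    where
    module ℕR = ℕ.≤-Reasoning
    same = 𝟙 (u′ ≟ u) ℕ.* 𝟙 (v′ ≟ v)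
    on : Carrier → Carrier → ℕ
    on s t = 𝟙 (s * u + t * v ≟ 1#)
    agree? : ∀ t → Dec (u′ + t * (v′ * u) ≈ u + t * (v * u′))
    agree? t = _ ≟ _
    agree : Carrier → ℕ
    agree t = 𝟙 (agree? t)
    agree-bound : ∑ all agree ≤ 1 ℕ.+ suc N ℕ.* same
    agree-bound with ∑𝟙-witness agree? all
    ... | inj₁ none = ≡.subst (_≤ _) (≡.sym none) z≤n
    ... | inj₂ (i , eq₀) = ℕR.begin
      ∑ all agree
        ℕR.≤⟨ ∑-mono all (λ t → 𝟙-bound (agree? t) (pointwise t)) ⟩
      ∑[ t ∈ all ] (𝟙 (t ≟ all i) ℕ.+ same)
        ℕR.≡⟨ ∑-+ all _ _ ⟩
      ∑[ t ∈ all ] 𝟙 (t ≟ all i) ℕ.+ ∑[ _ ∈ all ] same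
        ℕR.≡⟨ ≡.cong₂ ℕ._+_ (∑-single (all i)) (∑-const all same) ⟩
      1 ℕ.+ suc N ℕ.* same ℕR.∎
      where
      pointwise : ∀ t → u′ + t * (v′ * u) ≈ u + t * (v * u′) → 1 ≤ 𝟙 (t ≟ all i) ℕ.+ same
      pointwise t eq with t ≟ all i
      ... | yes _   = s≤s z≤n
      ... | no  t≉  = ℕ.*-mono-≤ (1≤𝟙 (u′ ≟ u) u′≈u) (1≤𝟙 (v′ ≟ v) v′≈v)
        where
        slopes : v′ * u ≈ v * u′
        slopes = equal-slopes eq eq₀ t≉
        u′≈u : u′ ≈ u
        u′≈u = +-cancelʳ _ _ _ (trans eq (+-congˡ (*-congˡ (sym slopes))))
        v′≈v : v′ ≈ v
        v′≈v = *-cancelʳ u≉0 (trans slopes (*-congˡ u′≈u))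

  -- The number of solutions of s x^A + t w^B = 1

  module SecondMoment {A B : ℕ} (1≤A : 1 ≤ A) (1≤B : 1 ≤ B) where
    module ℕR = ℕ.≤-Reasoning

    -- Here (s, t) is a point and (x, w) stands for the line with coefficients x^A and w^B, so that
    -- counting solutions means counting incidences.
    on : Carrier → Carrier → Carrier → Carrier → ℕ
    on s t x w = 𝟙 (s * x ^ A + t * w ^ B ≟ 1#)

    solutions : Carrier → Carrier → ℕ
    solutions s t = ∑[ x ∈ units ] ∑[ w ∈ units ] on s t x w

    -- Incidences are counted by lines: each of the N² pairs (x, w) gives a line with N + 1 points.
    first-moment : ∑[ s ∈ all ] ∑[ t ∈ all ] solutions s t ≡ N ℕ.* (N ℕ.* suc N)
    first-moment = ℕR.begin-equality
      ∑[ s ∈ all ] ∑[ t ∈ all ] ∑[ x ∈ units ] ∑[ w ∈ units ] on s t x w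
        ℕR.≡⟨ ∑-swap² all all units units on ⟩
      ∑[ x ∈ units ] ∑[ w ∈ units ] ∑[ s ∈ all ] ∑[ t ∈ all ] on s t x w
        ℕR.≡⟨ ∑-cong′ units (λ i → ∑-cong units (λ w → line-size (units i) w (units-≉0 i))) ⟩
      ∑[ x ∈ units ] ∑[ w ∈ units ] suc N
        ℕR.≡⟨ ≡.trans (∑-cong units (λ _ → ∑-const units (suc N))) (∑-const units _) ⟩
      N ℕ.* (N ℕ.* suc N) ℕR.∎
      where
      line-size : ∀ x w → x ≉ 0# → ∑[ s ∈ all ] ∑[ t ∈ all ] on s t x w ≡ suc N
      line-size x w x≉0 = ≡.trans (∑-swap all all _) (≡.trans
        (∑-cong all (λ t → line-points (w ^ B) t (^-≉0 A x≉0)))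
        (≡.trans (∑-const all 1) (ℕ.*-identityʳ (suc N))))

    equal-powers-≤ : ∀ {k} → 1 ≤ k → ∀ x → ∑[ x′ ∈ units ] 𝟙 (x′ ^ k ≟ x) ≤ k
    equal-powers-≤ 1≤k x = ℕ.≤-trans (∑-units≤all _) (power-roots 1≤k x)

    -- Each of the N² pairs (x′, w′) contributes at most 1, except that at most A B of them define
    -- the same line as (x, w) and may contribute N + 1 more.
    weighted-moment : ∀ {x w} → x ≉ 0# → w ≉ 0# →
      ∑[ s ∈ all ] ∑[ t ∈ all ] (on s t x w ℕ.* solutions s t) ≤ N ℕ.* N ℕ.+ suc N ℕ.* (A ℕ.* B)
    weighted-moment {x} {w} x≉0 w≉0 = ℕR.begin
      ∑[ s ∈ all ] ∑[ t ∈ all ] (on s t x w ℕ.* solutions s t)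
        ℕR.≡⟨ ∑-cong all (λ s → ∑-cong all (λ t → ≡.trans
                (∑-cong units (λ x′ → ∑-*ˡ units (on s t x w) (on s t x′))) (∑-*ˡ units (on s t x w) _))) ⟨
      ∑[ s ∈ all ] ∑[ t ∈ all ] ∑[ x′ ∈ units ] ∑[ w′ ∈ units ] (on s t x w ℕ.* on s t x′ w′)
        ℕR.≡⟨ ∑-swap² all all units units _ ⟩
      ∑[ x′ ∈ units ] ∑[ w′ ∈ units ] ∑[ s ∈ all ] ∑[ t ∈ all ] (on s t x w ℕ.* on s t x′ w′)
        ℕR.≤⟨ ∑-mono units (λ x′ → ∑-mono units (λ w′ → line-intersections (^-≉0 A x≉0) (^-≉0 B w≉0))) ⟩
      ∑[ x′ ∈ units ] ∑[ w′ ∈ units ] (1 ℕ.+ suc N ℕ.* (𝟙 (x′ ^ A ≟ x ^ A) ℕ.* 𝟙 (w′ ^ B ≟ w ^ B)))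
        ℕR.≡⟨ ∑-cong units (λ x′ → ≡.trans (∑-+ units _ _) (≡.cong₂ ℕ._+_ (∑-const units 1) (∑-*ˡ units (suc N) _))) ⟩
      ∑[ x′ ∈ units ] (N ℕ.* 1 ℕ.+ suc N ℕ.* ∑[ w′ ∈ units ] (𝟙 (x′ ^ A ≟ x ^ A) ℕ.* 𝟙 (w′ ^ B ≟ w ^ B)))
        ℕR.≡⟨ ≡.trans (∑-+ units _ _) (≡.cong₂ ℕ._+_ (∑-const units (N ℕ.* 1)) (∑-*ˡ units (suc N) _)) ⟩
      N ℕ.* (N ℕ.* 1) ℕ.+ suc N ℕ.* ∑[ x′ ∈ units ] ∑[ w′ ∈ units ] (𝟙 (x′ ^ A ≟ x ^ A) ℕ.* 𝟙 (w′ ^ B ≟ w ^ B))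
        ℕR.≡⟨ ≡.cong₂ (λ i j → N ℕ.* i ℕ.+ suc N ℕ.* j) (ℕ.*-identityʳ N) (∑-product units units _ _) ⟩
      N ℕ.* N ℕ.+ suc N ℕ.* (∑[ x′ ∈ units ] 𝟙 (x′ ^ A ≟ x ^ A) ℕ.* ∑[ w′ ∈ units ] 𝟙 (w′ ^ B ≟ w ^ B))
        ℕR.≤⟨ ℕ.+-monoʳ-≤ (N ℕ.* N) (ℕ.*-monoʳ-≤ (suc N)
                (ℕ.*-mono-≤ (equal-powers-≤ 1≤A (x ^ A)) (equal-powers-≤ 1≤B (w ^ B)))) ⟩
      N ℕ.* N ℕ.+ suc N ℕ.* (A ℕ.* B) ℕR.∎

    -- Expanding one factor of the square into incidences leaves N² instances of `weighted-moment`.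
    second-moment : ∑[ s ∈ all ] ∑[ t ∈ all ] (solutions s t ℕ.* solutions s t)
                    ≤ N ℕ.* (N ℕ.* (N ℕ.* N ℕ.+ suc N ℕ.* (A ℕ.* B)))
    second-moment = ℕR.begin
      ∑[ s ∈ all ] ∑[ t ∈ all ] (solutions s t ℕ.* solutions s t)
        ℕR.≡⟨ ∑-cong all (λ s → ∑-cong all (λ t → ≡.trans
                (∑-cong units (λ x → ∑-*ʳ units (solutions s t) (on s t x))) (∑-*ʳ units (solutions s t) _))) ⟨
      ∑[ s ∈ all ] ∑[ t ∈ all ] ∑[ x ∈ units ] ∑[ w ∈ units ] (on s t x w ℕ.* solutions s t)
        ℕR.≡⟨ ∑-swap² all all units units _ ⟩
      ∑[ x ∈ units ] ∑[ w ∈ units ] ∑[ s ∈ all ] ∑[ t ∈ all ] (on s t x w ℕ.* solutions s t)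
        ℕR.≤⟨ ∑-mono′ units (λ i → ∑-mono′ units (λ j → weighted-moment (units-≉0 i) (units-≉0 j))) ⟩
      ∑[ x ∈ units ] ∑[ w ∈ units ] (N ℕ.* N ℕ.+ suc N ℕ.* (A ℕ.* B))
        ℕR.≡⟨ ≡.trans (∑-cong units (λ _ → ∑-const units _)) (∑-const units _) ⟩
      N ℕ.* (N ℕ.* (N ℕ.* N ℕ.+ suc N ℕ.* (A ℕ.* B))) ℕR.∎

    module _ {s₀ t₀ : Carrier} (s₀≉0 : s₀ ≉ 0#) (t₀≉0 : t₀ ≉ 0#)
             (unsolvable : ∀ {x w} → x ≉ 0# → w ≉ 0# → s₀ * x ^ A + t₀ * w ^ B ≉ 1#) where

      -- The number of pairs (z, z′) of units with s = s₀ z^A and t = t₀ z′^B. As a weight it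
      -- replaces the set of such points: its total is N² and it is at most A B everywhere, so no
      -- set size has to be computed.
      multiplicity : Carrier → Carrier → ℕ
      multiplicity s t = fibre A s₀ s ℕ.* fibre B t₀ t

      ∑-multiplicity : ∑[ s ∈ all ] ∑[ t ∈ all ] multiplicity s t ≡ N ℕ.* N
      ∑-multiplicity = ≡.trans (∑-product all all (fibre A s₀) (fibre B t₀))
        (≡.cong₂ ℕ._*_ (∑-fibre A s₀) (∑-fibre B t₀))

      -- If (x, w) solved the equation for (s, t), then (z x, z′ w) would solve it for (s₀, t₀).
      solutions-zero : ∀ {s t z z′} → z ≉ 0# → z′ ≉ 0# → s ≈ s₀ * z ^ A → t ≈ t₀ * z′ ^ B →
                       solutions s t ≡ 0
      solutions-zero {s} {t} {z} {z′} z≉0 z′≉0 s≈ t≈ = ∑-zero units λ i → ∑-zero units λ j →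
        𝟙-no (_ ≟ 1#) λ eq → unsolvable (*-≉0 z≉0 (units-≉0 i)) (*-≉0 z′≉0 (units-≉0 j))
          (trans (+-cong (absorb A s≈) (absorb B t≈)) eq)
        where
        absorb : ∀ k {u v y x} → u ≈ v * y ^ k → v * (y * x) ^ k ≈ u * x ^ k
        absorb k {u} {v} {y} {x} eq = begin
          v * (y * x) ^ k      ≈⟨ *-congˡ (^-distrib-* y x k) ⟩
          v * (y ^ k * x ^ k)  ≈⟨ *-assoc _ _ _ ⟨
          v * y ^ k * x ^ k    ≈⟨ *-congʳ eq ⟨
          u * x ^ k            ∎

      solutions-multiplicity : ∀ s t → multiplicity s t ≡ 0 ⊎ solutions s t ≡ 0
      solutions-multiplicity s t
        with ∑𝟙-witness (λ z → s ≟ s₀ * z ^ A) units | ∑𝟙-witness (λ z → t ≟ t₀ * z ^ B) units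
      ... | inj₁ none     | _             = inj₁ (≡.cong (ℕ._* fibre B t₀ t) none)
      ... | inj₂ _        | inj₁ none     = inj₁ (≡.trans (≡.cong (fibre A s₀ s ℕ.*_) none) (ℕ.*-zeroʳ (fibre A s₀ s)))
      ... | inj₂ (i , s≈) | inj₂ (j , t≈) = inj₂ (solutions-zero (units-≉0 i) (units-≉0 j) s≈ t≈)

      -- multiplicity · μ² ≤ A B (solutions − μ)², without subtraction.
      deviation : ∀ μ s t →
        2 ℕ.* (A ℕ.* B) ℕ.* μ ℕ.* solutions s t ℕ.+ μ ℕ.* μ ℕ.* multiplicity s t
        ≤ A ℕ.* B ℕ.* (solutions s t ℕ.* solutions s t) ℕ.+ A ℕ.* B ℕ.* (μ ℕ.* μ)
      deviation μ s t with solutions-multiplicity s t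
      -- Without weight, what remains is A B (solutions - μ)² ≥ 0.
      ... | inj₁ eq rewrite eq = ℕR.begin
        2 ℕ.* (A ℕ.* B) ℕ.* μ ℕ.* f ℕ.+ μ ℕ.* μ ℕ.* 0  ℕR.≡⟨ lemma (A ℕ.* B) μ f ⟩
        A ℕ.* B ℕ.* (2 ℕ.* (f ℕ.* μ))                  ℕR.≤⟨ ℕ.*-monoʳ-≤ (A ℕ.* B) (2mn≤m²+n² f μ) ⟩
        A ℕ.* B ℕ.* (f ℕ.* f ℕ.+ μ ℕ.* μ)              ℕR.≡⟨ ℕ.*-distribˡ-+ (A ℕ.* B) (f ℕ.* f) (μ ℕ.* μ) ⟩
        A ℕ.* B ℕ.* (f ℕ.* f) ℕ.+ A ℕ.* B ℕ.* (μ ℕ.* μ) ℕR.∎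
        where
        f = solutions s t
        lemma : ∀ C μ f → 2 ℕ.* C ℕ.* μ ℕ.* f ℕ.+ μ ℕ.* μ ℕ.* 0 ≡ C ℕ.* (2 ℕ.* (f ℕ.* μ))
        lemma = solve-∀
      -- Without solutions, what remains is that the weight is at most A B.
      ... | inj₂ eq rewrite eq = ℕR.begin
        2 ℕ.* (A ℕ.* B) ℕ.* μ ℕ.* 0 ℕ.+ μ ℕ.* μ ℕ.* multiplicity s t
          ℕR.≡⟨ ≡.cong₂ ℕ._+_ (≡.trans (ℕ.*-zeroʳ (2 ℕ.* (A ℕ.* B) ℕ.* μ)) (≡.sym (ℕ.*-zeroʳ (A ℕ.* B)))) (ℕ.*-comm (μ ℕ.* μ) _) ⟩
        A ℕ.* B ℕ.* 0 ℕ.+ multiplicity s t ℕ.* (μ ℕ.* μ)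
          ℕR.≤⟨ ℕ.+-monoʳ-≤ (A ℕ.* B ℕ.* 0) (ℕ.*-monoˡ-≤ (μ ℕ.* μ) (ℕ.*-mono-≤ (fibre-≤ 1≤A s₀≉0 s) (fibre-≤ 1≤B t₀≉0 t))) ⟩
        A ℕ.* B ℕ.* 0 ℕ.+ A ℕ.* B ℕ.* (μ ℕ.* μ) ℕR.∎

      ∑∑-linear : ∀ (j k : ℕ) (f g : Carrier → Carrier → ℕ) →
        ∑[ s ∈ all ] ∑[ t ∈ all ] (j ℕ.* f s t ℕ.+ k ℕ.* g s t)
        ≡ j ℕ.* ∑[ s ∈ all ] ∑[ t ∈ all ] f s t ℕ.+ k ℕ.* ∑[ s ∈ all ] ∑[ t ∈ all ] g s t
      ∑∑-linear j k f g = ≡.trans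
        (∑-cong all λ s → ≡.trans (∑-+ all _ _) (≡.cong₂ ℕ._+_ (∑-*ˡ all j (f s)) (∑-*ˡ all k (g s))))
        (≡.trans (∑-+ all _ _) (≡.cong₂ ℕ._+_ (∑-*ˡ all j _) (∑-*ˡ all k _)))

      -- `deviation` summed over the plane, with both moments and the total weight inserted; `μ` is
      -- still free.
      variance-bound : ∀ μ →
        2 ℕ.* (A ℕ.* B) ℕ.* μ ℕ.* (N ℕ.* (N ℕ.* suc N)) ℕ.+ μ ℕ.* μ ℕ.* (N ℕ.* N)
        ≤ A ℕ.* B ℕ.* (N ℕ.* (N ℕ.* (N ℕ.* N ℕ.+ suc N ℕ.* (A ℕ.* B)))) ℕ.+ A ℕ.* B ℕ.* (suc N ℕ.* (suc N ℕ.* (μ ℕ.* μ)))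
      variance-bound μ = ℕR.begin
        2 ℕ.* C ℕ.* μ ℕ.* (N ℕ.* (N ℕ.* suc N)) ℕ.+ μ ℕ.* μ ℕ.* (N ℕ.* N)
          ℕR.≡⟨ ≡.cong₂ (λ i j → 2 ℕ.* C ℕ.* μ ℕ.* i ℕ.+ μ ℕ.* μ ℕ.* j) first-moment ∑-multiplicity ⟨
        2 ℕ.* C ℕ.* μ ℕ.* ∑[ s ∈ all ] ∑[ t ∈ all ] solutions s t
          ℕ.+ μ ℕ.* μ ℕ.* ∑[ s ∈ all ] ∑[ t ∈ all ] multiplicity s t
          ℕR.≡⟨ ∑∑-linear (2 ℕ.* C ℕ.* μ) (μ ℕ.* μ) solutions multiplicity ⟨
        ∑[ s ∈ all ] ∑[ t ∈ all ] (2 ℕ.* C ℕ.* μ ℕ.* solutions s t ℕ.+ μ ℕ.* μ ℕ.* multiplicity s t)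
          ℕR.≤⟨ ∑-mono all (λ s → ∑-mono all (deviation μ s)) ⟩
        ∑[ s ∈ all ] ∑[ t ∈ all ] (C ℕ.* (solutions s t ℕ.* solutions s t) ℕ.+ C ℕ.* (μ ℕ.* μ))
          ℕR.≡⟨ ∑∑-linear C C _ _ ⟩
        C ℕ.* ∑[ s ∈ all ] ∑[ t ∈ all ] (solutions s t ℕ.* solutions s t)
          ℕ.+ C ℕ.* ∑[ _ ∈ all ] ∑[ _ ∈ all ] (μ ℕ.* μ)
          ℕR.≤⟨ ℕ.+-mono-≤ (ℕ.*-monoʳ-≤ C second-moment)
                  (ℕ.≤-reflexive (≡.cong (C ℕ.*_) (≡.trans (∑-cong all (λ _ → ∑-const all (μ ℕ.* μ))) (∑-const all _)))) ⟩
        C ℕ.* (N ℕ.* (N ℕ.* (N ℕ.* N ℕ.+ suc N ℕ.* C))) ℕ.+ C ℕ.* (suc N ℕ.* (suc N ℕ.* (μ ℕ.* μ))) ℕR.∎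
        where C = A ℕ.* B

    diagonal-solvable : ∀ {s₀ t₀} → s₀ ≉ 0# → t₀ ≉ 0# → (A ℕ.* B ℕ.+ 3) ℕ.* (A ℕ.* B ℕ.+ 3) ≤ suc N →
      ∃[ x ] ∃[ w ] x ≉ 0# × w ≉ 0# × s₀ * x ^ A + t₀ * w ^ B ≈ 1#
    diagonal-solvable {s₀} {t₀} s₀≉0 t₀≉0 large
      with Fin.any? (λ i → Fin.any? (λ j → s₀ * units i ^ A + t₀ * units j ^ B ≟ 1#))
    ... | yes (i , j , eq) = units i , units j , units-≉0 i , units-≉0 j , eq
    -- The mean of `solutions` over the plane is N²/(N + 1) = N - 1 + 1/(N + 1); μ is taken to be
    -- its integer part.
    ... | no  none = contradiction (variance-bound s₀≉0 t₀≉0 unsolvable (ℕ.pred N))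
      (ℕ.<⇒≱ (variance-large (A ℕ.* B) N large))
      where
      unsolvable : ∀ {x w} → x ≉ 0# → w ≉ 0# → s₀ * x ^ A + t₀ * w ^ B ≉ 1#
      unsolvable x≉0 w≉0 eq with i , eqᵢ ← units-surjective x≉0 | j , eqⱼ ← units-surjective w≉0 =
        none (i , j , trans (+-cong (*-congˡ (^-congˡ A eqᵢ)) (*-congˡ (^-congˡ B eqⱼ))) eq)

-- The Frobenius map and (q^k − 1)-th powers

-- `Finite` needs the number of elements in the form `suc N`, which q^n has only up to propositional
-- equality. Only the enumeration is transported, so elements and operations stay the same.
resize : ∀ {M N c ℓ} → M ≡ N → FiniteField M c ℓ → FiniteField N c ℓ
resize M≡N F = record
  { commutativeRing = commutativeRing
  ; 1≉0             = 1≉0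
  ; invertible      = invertible
  ; enumeration     = ≡.subst (λ N → Inverse setoid (≡.setoid (Fin N))) M≡N enumeration
  }
  where open FiniteField F

module PowersOf {q} (1<q : 1 < q) where

  instance
    q≢0 : ℕ.NonZero q
    q≢0 = ℕ.>-nonZero (ℕ.<⇒≤ 1<q)

  -- The exponent of x ↦ x ^ q ^ k / x.
  Δ : ℕ → ℕ
  Δ k = q ℕ.^ k ℕ.∸ 1

  suc-Δ : ∀ k → suc (Δ k) ≡ q ℕ.^ k
  suc-Δ k = ℕ.m+[n∸m]≡n (ℕ.m^n>0 q k)

  Δ-≥1 : ∀ {k} → 1 ≤ k → 1 ≤ Δ k
  Δ-≥1 {suc k} _ = ℕ.m<n⇒0<n∸m (ℕ.^-monoʳ-< q 1<q (ℕ.z<s {k}))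

  -- (q^j - 1) + q^j (q^l - 1) telescopes. This cocycle rule lets statements about `Δ` be added and
  -- subtracted in the index.
  Δ-+ : ∀ j l → Δ (j ℕ.+ l) ≡ Δ j ℕ.+ q ℕ.^ j ℕ.* Δ l
  Δ-+ j l = ℕ.suc-injective (begin
    suc (Δ (j ℕ.+ l))                ≡⟨ suc-Δ (j ℕ.+ l) ⟩
    q ℕ.^ (j ℕ.+ l)                  ≡⟨ ℕ.^-distribˡ-+-* q j l ⟩
    q ℕ.^ j ℕ.* q ℕ.^ l              ≡⟨ ≡.cong (q ℕ.^ j ℕ.*_) (suc-Δ l) ⟨
    q ℕ.^ j ℕ.* suc (Δ l)            ≡⟨ ℕ.*-suc (q ℕ.^ j) (Δ l) ⟩
    q ℕ.^ j ℕ.+ q ℕ.^ j ℕ.* Δ l      ≡⟨ ≡.cong (ℕ._+ q ℕ.^ j ℕ.* Δ l) (suc-Δ j) ⟨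
    suc (Δ j ℕ.+ q ℕ.^ j ℕ.* Δ l)    ∎)
    where open ≡.≡-Reasoning

  Δ-∣ : ∀ {e k} → e ∣ k → Δ e ∣ Δ k
  Δ-∣ {e} (divides j ≡.refl) = multiple j
    where
    multiple : ∀ j → Δ e ∣ Δ (j ℕ.* e)
    multiple zero    = Δ e ∣0
    multiple (suc j) = ≡.subst (Δ e ∣_) (≡.sym (Δ-+ e (j ℕ.* e)))
      (∣m∣n⇒∣m+n ∣-refl (∣n⇒∣m*n (q ℕ.^ e) (multiple j)))

  Δ-large : ∀ {k m n} → 1 ≤ k → 1 ≤ m → 2 ℕ.* (k ℕ.+ m) ≤ n →
            (Δ k ℕ.* Δ m ℕ.+ 3) ℕ.* (Δ k ℕ.* Δ m ℕ.+ 3) ≤ q ℕ.^ n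
  Δ-large {k} {m} {n} 1≤k 1≤m 2[k+m]≤n = begin
    (Δ k ℕ.* Δ m ℕ.+ 3) ℕ.* (Δ k ℕ.* Δ m ℕ.+ 3)  ≤⟨ ℕ.*-mono-≤ root root ⟩
    q ℕ.^ (k ℕ.+ m) ℕ.* q ℕ.^ (k ℕ.+ m)          ≡⟨ ℕ.^-distribˡ-+-* q (k ℕ.+ m) (k ℕ.+ m) ⟨
    q ℕ.^ (k ℕ.+ m ℕ.+ (k ℕ.+ m))                ≡⟨ ≡.cong (λ i → q ℕ.^ (k ℕ.+ m ℕ.+ i)) (ℕ.+-identityʳ (k ℕ.+ m)) ⟨
    q ℕ.^ (2 ℕ.* (k ℕ.+ m))                      ≤⟨ ℕ.^-monoʳ-≤ q 2[k+m]≤n ⟩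
    q ℕ.^ n                                      ∎
    where
    open ℕ.≤-Reasoning
    expand : ∀ i j → suc i ℕ.* suc j ≡ i ℕ.* j ℕ.+ (1 ℕ.+ i ℕ.+ j)
    expand = solve-∀
    -- The 3 comes from expanding (`Δ k` + 1)(`Δ m` + 1): besides the product there are 1, `Δ k` and
    -- `Δ m`, each at least 1.
    root : Δ k ℕ.* Δ m ℕ.+ 3 ≤ q ℕ.^ (k ℕ.+ m)
    root = begin
      Δ k ℕ.* Δ m ℕ.+ 3                   ≤⟨ ℕ.+-monoʳ-≤ (Δ k ℕ.* Δ m) (ℕ.+-mono-≤ (s≤s (Δ-≥1 1≤k)) (Δ-≥1 1≤m)) ⟩
      Δ k ℕ.* Δ m ℕ.+ (1 ℕ.+ Δ k ℕ.+ Δ m) ≡⟨ expand (Δ k) (Δ m) ⟨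
      suc (Δ k) ℕ.* suc (Δ m)             ≡⟨ ≡.cong₂ ℕ._*_ (suc-Δ k) (suc-Δ m) ⟩
      q ℕ.^ k ℕ.* q ℕ.^ m                 ≡⟨ ℕ.^-distribˡ-+-* q k m ⟨
      q ℕ.^ (k ℕ.+ m)                     ∎

module Frobenius {q n c ℓ} (1<q : 1 < q) (1≤n : 1 ≤ n) (F : FiniteField (q ℕ.^ n) c ℓ) where
  open PowersOf 1<q
  open FiniteField F hiding (_^_; zero)
  open Finite (resize (≡.sym (suc-Δ n)) F) public
  open RingSolver commutativeSemiring using (solve; _:=_; _:+_; _:*_)
  open SetoidReasoning setoid

  ^q^n : ∀ {z} → z ≉ 0# → z ^ (q ℕ.^ n) ≈ z
  ^q^n {z} z≉0 = begin
    z ^ (q ℕ.^ n)  ≈⟨ ^-congʳ z (suc-Δ n) ⟨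
    z * z ^ Δ n    ≈⟨ *-congˡ (fermat z≉0) ⟩
    z * 1#         ≈⟨ *-identityʳ z ⟩
    z              ∎

  ^q^jn : ∀ {z} j → z ≉ 0# → z ^ (q ℕ.^ (j ℕ.* n)) ≈ z
  ^q^jn {z} zero    z≉0 = *-identityʳ z
  ^q^jn {z} (suc j) z≉0 = begin
    z ^ (q ℕ.^ (n ℕ.+ j ℕ.* n))          ≈⟨ ^-congʳ z (ℕ.^-distribˡ-+-* q n (j ℕ.* n)) ⟩
    z ^ (q ℕ.^ n ℕ.* q ℕ.^ (j ℕ.* n))    ≈⟨ ^-assocʳ z (q ℕ.^ n) (q ℕ.^ (j ℕ.* n)) ⟨
    (z ^ (q ℕ.^ n)) ^ (q ℕ.^ (j ℕ.* n))  ≈⟨ ^-congˡ (q ℕ.^ (j ℕ.* n)) (^q^n z≉0) ⟩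
    z ^ (q ℕ.^ (j ℕ.* n))                ≈⟨ ^q^jn j z≉0 ⟩
    z                                    ∎

  frobenius-surjective : ∀ k {z} → z ≉ 0# → ∃[ y ] y ≉ 0# × y ^ (q ℕ.^ k) ≈ z
  frobenius-surjective k {z} z≉0 = z ^ (q ℕ.^ i) , ^-≉0 (q ℕ.^ i) z≉0 , (begin
    (z ^ (q ℕ.^ i)) ^ (q ℕ.^ k)  ≈⟨ ^-assocʳ z (q ℕ.^ i) (q ℕ.^ k) ⟩
    z ^ (q ℕ.^ i ℕ.* q ℕ.^ k)    ≈⟨ ^-congʳ z (ℕ.^-distribˡ-+-* q i k) ⟨
    z ^ (q ℕ.^ (i ℕ.+ k))        ≈⟨ ^-congʳ z (≡.cong (q ℕ.^_) (ℕ.m∸n+n≡m k≤kn)) ⟩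
    z ^ (q ℕ.^ (k ℕ.* n))        ≈⟨ ^q^jn k z≉0 ⟩
    z                            ∎)
    where
    -- A multiple of n Frobenius steps is the identity on units, and kn is a multiple of n that is
    -- at least k, so kn - k steps undo k steps.
    i = k ℕ.* n ℕ.∸ k
    k≤kn : k ≤ k ℕ.* n
    k≤kn = ℕ.m≤m*n k n {{ℕ.>-nonZero 1≤n}}

  ^q^ : ∀ z k → z ^ (q ℕ.^ k) ≈ z * z ^ Δ k
  ^q^ z k = ^-congʳ z (≡.sym (suc-Δ k))

  ^q^-+ : ∀ z j l → z ^ (q ℕ.^ (j ℕ.+ l)) ≈ z ^ (q ℕ.^ j) * (z ^ (q ℕ.^ j)) ^ Δ l
  ^q^-+ z j l = begin
    z ^ (q ℕ.^ (j ℕ.+ l))                ≈⟨ ^-congʳ z (ℕ.^-distribˡ-+-* q j l) ⟩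
    z ^ (q ℕ.^ j ℕ.* q ℕ.^ l)            ≈⟨ ^-assocʳ z (q ℕ.^ j) (q ℕ.^ l) ⟨
    (z ^ (q ℕ.^ j)) ^ (q ℕ.^ l)          ≈⟨ ^q^ (z ^ (q ℕ.^ j)) l ⟩
    z ^ (q ℕ.^ j) * (z ^ (q ℕ.^ j)) ^ Δ l ∎

  ^Δ-+ : ∀ z j l → z ^ Δ (j ℕ.+ l) ≈ z ^ Δ j * (z ^ (q ℕ.^ j)) ^ Δ l
  ^Δ-+ z j l = begin
    z ^ Δ (j ℕ.+ l)                    ≈⟨ ^-congʳ z (Δ-+ j l) ⟩
    z ^ (Δ j ℕ.+ q ℕ.^ j ℕ.* Δ l)      ≈⟨ ^-homo-* z (Δ j) _ ⟩
    z ^ Δ j * z ^ (q ℕ.^ j ℕ.* Δ l)    ≈⟨ *-congˡ (^-assocʳ z (q ℕ.^ j) (Δ l)) ⟨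
    z ^ Δ j * (z ^ (q ℕ.^ j)) ^ Δ l    ∎

  *-interchange : ∀ u v x y → (u * v) * (x * y) ≈ (u * x) * (v * y)
  *-interchange = solve 4 (λ u v x y → (u :* v) :* (x :* y) := (u :* x) :* (v :* y)) refl

  ⁻¹-^ : ∀ {z} (z≉0 : z ≉ 0#) k → z ^ k * (z≉0 ⁻¹) ^ k ≈ 1#
  ⁻¹-^ {z} z≉0 k = begin
    z ^ k * (z≉0 ⁻¹) ^ k  ≈⟨ ^-distrib-* _ _ k ⟨
    (z * z≉0 ⁻¹) ^ k      ≈⟨ ^-congˡ k (⁻¹-inverseʳ z≉0) ⟩
    1# ^ k                ≈⟨ 1^n≈1 k ⟩
    1#                    ∎

  -- Ratios of two Frobenius images of one element.

  twist-up : ∀ h m {y w} → y ^ (q ℕ.^ h) ≈ w → y ^ (q ℕ.^ (h ℕ.+ m)) ≈ y ^ (q ℕ.^ h) * w ^ Δ m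
  twist-up h m {y} eq = trans (^q^-+ y h m) (*-congˡ (^-congˡ (Δ m) eq))

  twist-down : ∀ d m {y w} → y ^ (q ℕ.^ d) * w ≈ 1# → y ^ (q ℕ.^ d) ≈ y ^ (q ℕ.^ (d ℕ.+ m)) * w ^ Δ m
  twist-down d m {y} {w} eq = sym (begin
    y ^ (q ℕ.^ (d ℕ.+ m)) * w ^ Δ m    ≈⟨ *-congʳ (^q^-+ y d m) ⟩
    Y * Y ^ Δ m * w ^ Δ m              ≈⟨ *-assoc _ _ _ ⟩
    Y * (Y ^ Δ m * w ^ Δ m)            ≈⟨ *-congˡ (^-distrib-* Y w (Δ m)) ⟨
    Y * (Y * w) ^ Δ m                  ≈⟨ *-congˡ (trans (^-congˡ (Δ m) eq) (1^n≈1 (Δ m))) ⟩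
    Y * 1#                             ≈⟨ *-identityʳ Y ⟩
    Y                                  ∎)
    where Y = y ^ (q ℕ.^ d)

  -- For units: y^(q^d) / y^(q^h) is the (q^m - 1)-th power of w, m = |d - h|. The sign of d - h
  -- affects only the choice of w, which is y^(q^h) for d = h + m and the inverse of y^(q^d) for h =
  -- d + m.
  Twist : ℕ → ℕ → Carrier → Carrier → Set ℓ
  Twist d h y w = y ^ (q ℕ.^ d) ≈ y ^ (q ℕ.^ h) * w ^ Δ ℕ.∣ d - h ∣

  ∣-∣-cases : ∀ d h → (∃[ m ] d ≡ h ℕ.+ m × ℕ.∣ d - h ∣ ≡ m) ⊎ (∃[ m ] h ≡ d ℕ.+ m × ℕ.∣ d - h ∣ ≡ m)
  ∣-∣-cases d h with ℕ.≤-total h d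
  ... | inj₁ h≤d with m , ≡.refl ← ℕ.m≤n⇒∃[o]m+o≡n h≤d =
    inj₁ (m , ≡.refl , ≡.trans (ℕ.∣-∣-comm (h ℕ.+ m) h) (ℕ.∣m-m+n∣≡n h m))
  ... | inj₂ d≤h with m , ≡.refl ← ℕ.m≤n⇒∃[o]m+o≡n d≤h = inj₂ (m , ≡.refl , ℕ.∣m-m+n∣≡n d m)

  twist : ∀ d h {y} → y ≉ 0# → ∃[ w ] w ≉ 0# × Twist d h y w
  twist d h {y} y≉0 with ∣-∣-cases d h
  ... | inj₁ (m , ≡.refl , eq) rewrite eq = y ^ (q ℕ.^ h) , ^-≉0 (q ℕ.^ h) y≉0 , twist-up h m refl
  ... | inj₂ (m , ≡.refl , eq) rewrite eq = Y≉0 ⁻¹ , ⁻¹-≉0 Y≉0 , twist-down d m (⁻¹-inverseʳ Y≉0)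
    where
    Y≉0 : y ^ (q ℕ.^ d) ≉ 0#
    Y≉0 = ^-≉0 (q ℕ.^ d) y≉0

  -- Frobenius powers are surjective on units, so the w attached to y can be prescribed.
  untwist : ∀ d h {w} → w ≉ 0# → ∃[ y ] y ≉ 0# × Twist d h y w
  untwist d h w≉0 with ∣-∣-cases d h
  ... | inj₁ (m , ≡.refl , eq) rewrite eq with y , y≉0 , yʰ≈w ← frobenius-surjective h w≉0 =
    y , y≉0 , twist-up h m yʰ≈w
  ... | inj₂ (m , ≡.refl , eq) rewrite eq with y , y≉0 , yᵈ≈w⁻¹ ← frobenius-surjective d (⁻¹-≉0 w≉0) =
    y , y≉0 , twist-down d m (trans (*-congʳ yᵈ≈w⁻¹) (⁻¹-inverseˡ w≉0))

  -- The subgroup of products of (q^k - 1)-th and (q^m - 1)-th powers.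

  module PowerProducts (k m : ℕ) where

    -- Membership in this subgroup; the second factor of u is the inverse of `w ^ Δ m`, moved across
    -- to avoid division.
    Representable : Carrier → Set (c ⊔ ℓ)
    Representable u = ∃[ x ] ∃[ w ] x ≉ 0# × w ≉ 0# × x ^ Δ k ≈ u * w ^ Δ m

    -- The exponents Δ j of which all values are representable stand in for the
    -- subgroup of ℤ generated by Δ k, Δ m and Δ n.
    Good : ℕ → Set (c ⊔ ℓ)
    Good j = ∀ {z} → z ≉ 0# → Representable (z ^ Δ j)

    resp : ∀ {u v} → u ≈ v → Representable u → Representable v
    resp u≈v (x , w , x≉0 , w≉0 , eq) = x , w , x≉0 , w≉0 , trans eq (*-congʳ u≈v)

    representable-* : ∀ {u v} → Representable u → Representable v → Representable (u * v)
    representable-* {u} {v} (x , w , x≉0 , w≉0 , eq) (x′ , w′ , x′≉0 , w′≉0 , eq′) =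
      x * x′ , w * w′ , *-≉0 x≉0 x′≉0 , *-≉0 w≉0 w′≉0 , (begin
      (x * x′) ^ Δ k                     ≈⟨ ^-distrib-* x x′ (Δ k) ⟩
      x ^ Δ k * x′ ^ Δ k                 ≈⟨ *-cong eq eq′ ⟩
      (u * w ^ Δ m) * (v * w′ ^ Δ m)     ≈⟨ *-interchange u _ v _ ⟩
      (u * v) * (w ^ Δ m * w′ ^ Δ m)     ≈⟨ *-congˡ (^-distrib-* w w′ (Δ m)) ⟨
      (u * v) * (w * w′) ^ Δ m           ∎)

    representable-/ : ∀ {u v} → u ≉ 0# → Representable (u * v) → Representable u → Representable v
    representable-/ {u} {v} u≉0 uv-rep (x , w , x≉0 , w≉0 , eq) =
      resp (trans (sym (*-assoc _ _ _)) (trans (*-congʳ (⁻¹-inverseˡ u≉0)) (*-identityˡ v)))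
        (representable-* (x≉0 ⁻¹ , w≉0 ⁻¹ , ⁻¹-≉0 x≉0 , ⁻¹-≉0 w≉0 , inverse-eq) uv-rep)
      where
      X = x ^ Δ k
      W = w ^ Δ m
      inverse-eq : (x≉0 ⁻¹) ^ Δ k ≈ u≉0 ⁻¹ * (w≉0 ⁻¹) ^ Δ m
      inverse-eq = *-cancelˡ (^-≉0 (Δ k) x≉0) (begin
        X * (x≉0 ⁻¹) ^ Δ k                       ≈⟨ ⁻¹-^ x≉0 (Δ k) ⟩
        1#                                       ≈⟨ *-identityˡ 1# ⟨
        1# * 1#                                  ≈⟨ *-cong (⁻¹-inverseʳ u≉0) (⁻¹-^ w≉0 (Δ m)) ⟨
        (u * u≉0 ⁻¹) * (W * (w≉0 ⁻¹) ^ Δ m)      ≈⟨ *-interchange u _ W _ ⟩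
        (u * W) * (u≉0 ⁻¹ * (w≉0 ⁻¹) ^ Δ m)      ≈⟨ *-congʳ eq ⟨
        X * (u≉0 ⁻¹ * (w≉0 ⁻¹) ^ Δ m)            ∎)

    representable-1 : ∀ {u} → u ≈ 1# → Representable u
    representable-1 {u} u≈1 = 1# , 1# , 1≉0 , 1≉0 , (begin
      1# ^ Δ k      ≈⟨ 1^n≈1 (Δ k) ⟩
      1#            ≈⟨ *-identityˡ 1# ⟨
      1# * 1#       ≈⟨ *-cong u≈1 (1^n≈1 (Δ m)) ⟨
      u * 1# ^ Δ m  ∎)

    good-k : Good k
    good-k {z} z≉0 = z , 1# , z≉0 , 1≉0 , sym (trans (*-congˡ (1^n≈1 (Δ m))) (*-identityʳ _))

    good-m : Good m
    good-m z≉0 = 1# , z≉0 ⁻¹ , 1≉0 , ⁻¹-≉0 z≉0 , trans (1^n≈1 (Δ k)) (sym (⁻¹-^ z≉0 (Δ m)))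

    good-n : Good n
    good-n z≉0 = representable-1 (fermat z≉0)

    good-+ : ∀ i {j} → Good i → Good j → Good (i ℕ.+ j)
    good-+ i {j} gᵢ gⱼ {z} z≉0 =
      resp (sym (^Δ-+ z i j)) (representable-* (gᵢ z≉0) (gⱼ (^-≉0 (q ℕ.^ i) z≉0)))

    -- Every unit z is some y^(q^i), and then `z ^ Δ j` is the quotient of `y ^ Δ (i + j)` by
    -- `y ^ Δ i`.
    good-∸ : ∀ i {j} → Good (i ℕ.+ j) → Good i → Good j
    good-∸ i {j} gᵢ₊ⱼ gᵢ {z} z≉0 with y , y≉0 , yⁱ≈z ← frobenius-surjective i z≉0 =
      resp (^-congˡ (Δ j) yⁱ≈z)
        (representable-/ (^-≉0 (Δ i) y≉0) (resp (^Δ-+ y i j) (gᵢ₊ⱼ y≉0)) (gᵢ y≉0))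

    good-* : ∀ x i → Good i → Good (x ℕ.* i)
    good-* zero    i gᵢ _ = representable-1 refl
    good-* (suc x) i gᵢ   = good-+ i gᵢ (good-* x i gᵢ)

    -- By Bézout over the naturals, the gcd is a difference of multiples of i and j; the two cases
    -- say which multiple is larger.
    good-gcd : ∀ i j → Good i → Good j → Good (gcd i j)
    good-gcd i j gᵢ gⱼ with Bézout.identity (gcd-GCD i j)
    ... | Bézout.+- x y eq = good-∸ (y ℕ.* j)
      (≡.subst Good (≡.trans (≡.sym eq) (ℕ.+-comm _ (y ℕ.* j))) (good-* x i gᵢ)) (good-* y j gⱼ)
    ... | Bézout.-+ x y eq = good-∸ (x ℕ.* i)
      (≡.subst Good (≡.trans (≡.sym eq) (ℕ.+-comm _ (x ℕ.* i))) (good-* y j gⱼ)) (good-* x i gᵢ)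

    module _ {M : ℕ} (ΔeM≡Δn : Δ (gcd n (gcd k m)) ℕ.* M ≡ Δ n) (1≤M : 1 ≤ M) where

      -- With e the gcd, `Δ e` divides `Δ j`, so the total exponent is a multiple of `Δ n` and
      -- Fermat applies.
      ^-killed : ∀ {j x} → gcd n (gcd k m) ∣ j → x ≉ 0# → (x ^ Δ j) ^ M ≈ 1#
      ^-killed {j} {x} e∣j x≉0 with divides i eq ← Δ-∣ e∣j = begin
        (x ^ Δ j) ^ M        ≈⟨ ^-assocʳ x (Δ j) M ⟩
        x ^ (Δ j ℕ.* M)      ≈⟨ ^-congʳ x (≡.trans (≡.cong (ℕ._* M) eq) (≡.trans (ℕ.*-assoc i _ M)
                                  (≡.trans (≡.cong (i ℕ.*_) ΔeM≡Δn) (ℕ.*-comm i (Δ n))))) ⟩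
        x ^ (Δ n ℕ.* i)      ≈⟨ ^-assocʳ x (Δ n) i ⟨
        (x ^ Δ n) ^ i        ≈⟨ trans (^-congˡ i (fermat x≉0)) (1^n≈1 i) ⟩
        1#                   ∎

      -- Raising to the power M kills both factors. Conversely, `isPower` makes u a (q^e - 1)-th
      -- power, e being the gcd, and `good-gcd` represents it.
      representable⇔ : ∀ {u} → Representable u ⇔ (u ^ M ≈ 1#)
      representable⇔ {u} = mk⇔ to from
        where
        e∣[k,m] : gcd n (gcd k m) ∣ gcd k m
        e∣[k,m] = gcd[m,n]∣n n (gcd k m)
        to : Representable u → u ^ M ≈ 1#
        to (x , w , x≉0 , w≉0 , eq) = begin
          u ^ M                    ≈⟨ *-identityʳ _ ⟨
          u ^ M * 1#               ≈⟨ *-congˡ (^-killed (∣-trans e∣[k,m] (gcd[m,n]∣n k m)) w≉0) ⟨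
          u ^ M * (w ^ Δ m) ^ M    ≈⟨ ^-distrib-* u _ M ⟨
          (u * w ^ Δ m) ^ M        ≈⟨ ^-congˡ M eq ⟨
          (x ^ Δ k) ^ M            ≈⟨ ^-killed (∣-trans e∣[k,m] (gcd[m,n]∣m k m)) x≉0 ⟩
          1#                       ∎
        1≤Δe : 1 ≤ Δ (gcd n (gcd k m))
        1≤Δe = Δ-≥1 (ℕ.n≢0⇒n>0 (gcd[m,n]≢0 n (gcd k m) (inj₁ (ℕ.m<n⇒n≢0 1≤n))))
        from : u ^ M ≈ 1# → Representable u
        from uᴹ≈1 with z , z≉0 , u≈ ← isPower 1≤Δe ΔeM≡Δn 1≤M uᴹ≈1 =
          resp (sym u≈) (good-gcd n (gcd k m) good-n (good-gcd k m good-k good-m) z≉0)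

-- Intersection of the linear sets

module Intersection {q n c ℓ} (q-primePower : PrimePower q) (2≤n : 2 ≤ n)
                    (F : FiniteField (q ℕ.^ n) c ℓ) where
  private
    1<q = primePower⇒1<q q-primePower
    1≤n = ℕ.<⇒≤ 2≤n
  open PowersOf 1<q
  open FiniteField F hiding (_^_; zero)
  open LinearSets q-primePower 2≤n F
  open Frobenius {n = n} 1<q 1≤n F
  open RingSolver commutativeSemiring using (solve; _:=_; _:+_; _:*_)
  open SetoidReasoning setoid

  -- The equation is the vanishing of the determinant of the two vectors; the scalar s for the first
  -- becomes s x / y for the second.
  ⟨⟩-⊆ : ∀ {x u y v} → y ≉ 0# → u * y ≈ x * v → ⟨ x , u ⟩ ⊆ ⟨ y , v ⟩
  ⟨⟩-⊆ {x} {u} {y} {v} y≉0 eq (s , sx≈ , su≈) = s * x * y≉0 ⁻¹ , trans first sx≈ , trans second su≈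
    where
    first : s * x * y≉0 ⁻¹ * y ≈ s * x
    first = trans (*-assoc _ _ _) (trans (*-congˡ (⁻¹-inverseˡ y≉0)) (*-identityʳ _))
    second : s * x * y≉0 ⁻¹ * v ≈ s * u
    second = begin
      s * x * y≉0 ⁻¹ * v      ≈⟨ solve 4 (λ s x i v → s :* x :* i :* v := s :* i :* (x :* v)) refl s x (y≉0 ⁻¹) v ⟩
      s * y≉0 ⁻¹ * (x * v)    ≈⟨ *-congˡ eq ⟨
      s * y≉0 ⁻¹ * (u * y)    ≈⟨ solve 4 (λ s i u y → s :* i :* (u :* y) := s :* u :* (i :* y)) refl s (y≉0 ⁻¹) u y ⟩
      s * u * (y≉0 ⁻¹ * y)    ≈⟨ *-congˡ (⁻¹-inverseˡ y≉0) ⟩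
      s * u * 1#              ≈⟨ *-identityʳ _ ⟩
      s * u                   ∎

  meet⇔ : ∀ g h f → Satisfiable (L g ∩ L[ h ] f) ⇔
          (∃[ x ] ∃[ y ] x ≉ 0# × y ≉ 0# × g x * y ^ (q ℕ.^ h) ≈ x * f y)
  meet⇔ g h f = mk⇔ to from
    where
    Proportional : Set _
    Proportional = ∃[ x ] ∃[ y ] x ≉ 0# × y ≉ 0# × g x * y ^ (q ℕ.^ h) ≈ x * f y
    to : Satisfiable (L g ∩ L[ h ] f) → Proportional
    to ((S , _) , (x , x≉0 , S⊆g , _) , (y , y≉0 , _ , f⊆S))
      -- The generator (y^(q^h), f y), in its own span with scalar 1, lies in `S` and hence is a
      -- multiple of (x, g x).
      with s , sx≈ , sg≈ ← S⊆g (f⊆S (1# , *-identityˡ _ , *-identityˡ _)) = x , y , x≉0 , y≉0 , (begin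
        g x * y ^ (q ℕ.^ h)  ≈⟨ *-congˡ sx≈ ⟨
        g x * (s * x)        ≈⟨ solve 3 (λ u s x → u :* (s :* x) := x :* (s :* u)) refl (g x) s x ⟩
        x * (s * g x)        ≈⟨ *-congˡ sg≈ ⟩
        x * f y              ∎)
    from : Proportional → Satisfiable (L g ∩ L[ h ] f)
    from (x , y , x≉0 , y≉0 , eq) =
      (⟨ x , g x ⟩ , (x , g x) , (λ (x≈0 , _) → x≉0 x≈0) , ≐-refl) ,
      (x , x≉0 , ≐-refl) ,
      (y , y≉0 , ⟨⟩-⊆ (^-≉0 (q ℕ.^ h) y≉0) eq ,
        ⟨⟩-⊆ x≉0 (trans (*-comm _ _) (trans (sym eq) (*-comm _ _))))

  module _ (α β a : Carrier) (k d h : ℕ) where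

    private
      r : ℕ
      r = ℕ.∣ d - h ∣
      g f : Carrier → Carrier
      g x = α * x ^ (q ℕ.^ k) + β * x
      f y = a * y ^ (q ℕ.^ d)

    -- The proportionality equation divided by x y^(q^h), with w carrying the ratio y^(q^d) /
    -- y^(q^h).
    Diagonal : Set (c ⊔ ℓ)
    Diagonal = ∃[ x ] ∃[ w ] x ≉ 0# × w ≉ 0# × α * x ^ Δ k + β ≈ a * w ^ Δ r

    module _ {x y w : Carrier} (tw : Twist d h y w) where

      private
        Y = y ^ (q ℕ.^ h)

      g-factor : g x * Y ≈ x * Y * (α * x ^ Δ k + β)
      g-factor = begin
        (α * x ^ (q ℕ.^ k) + β * x) * Y   ≈⟨ *-congʳ (+-congʳ (*-congˡ (^q^ x k))) ⟩
        (α * (x * x ^ Δ k) + β * x) * Y   ≈⟨ solve 5 (λ α β x X Y →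
          (α :* (x :* X) :+ β :* x) :* Y := x :* Y :* (α :* X :+ β)) refl α β x (x ^ Δ k) Y ⟩
        x * Y * (α * x ^ Δ k + β)         ∎

      f-factor : x * f y ≈ x * Y * (a * w ^ Δ r)
      f-factor = begin
        x * (a * y ^ (q ℕ.^ d))    ≈⟨ *-congˡ (*-congˡ tw) ⟩
        x * (a * (Y * w ^ Δ r))    ≈⟨ solve 4 (λ x a Y W →
          x :* (a :* (Y :* W)) := x :* Y :* (a :* W)) refl x a Y (w ^ Δ r) ⟩
        x * Y * (a * w ^ Δ r)      ∎

    meet⇔diagonal : Satisfiable (L g ∩ L[ h ] f) ⇔ Diagonal
    meet⇔diagonal = mk⇔ (to ∘ Equivalence.to (meet⇔ g h f)) (Equivalence.from (meet⇔ g h f) ∘ from)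
      where
      Proportional : Set _
      Proportional = ∃[ x ] ∃[ y ] x ≉ 0# × y ≉ 0# × g x * y ^ (q ℕ.^ h) ≈ x * f y
      to : Proportional → Diagonal
      to (x , y , x≉0 , y≉0 , eq) with w , w≉0 , tw ← twist d h y≉0 =
        x , w , x≉0 , w≉0 , *-cancelˡ (*-≉0 x≉0 (^-≉0 (q ℕ.^ h) y≉0))
          (trans (sym (g-factor tw)) (trans eq (f-factor tw)))
      from : Diagonal → Proportional
      from (x , w , x≉0 , w≉0 , eq) with y , y≉0 , tw ← untwist d h w≉0 =
        x , y , x≉0 , y≉0 , trans (g-factor tw) (trans (*-congˡ eq) (sym (f-factor tw)))

    module _ (α≉0 : α ≉ 0#) where

      open PowerProducts k r using (Representable; representable⇔)

      diagonal⇔representable : β ≈ 0# → Diagonal ⇔ Representable (a * α≉0 ⁻¹)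
      diagonal⇔representable β≈0 = mk⇔
        (λ (x , w , x≉0 , w≉0 , eq) → x , w , x≉0 , w≉0 , *-cancelˡ α≉0
          (trans (sym (drop-β x)) (trans eq (sym (clear w)))))
        (λ (x , w , x≉0 , w≉0 , eq) → x , w , x≉0 , w≉0 ,
          trans (drop-β x) (trans (*-congˡ eq) (clear w)))
        where
        drop-β : ∀ x → α * x ^ Δ k + β ≈ α * x ^ Δ k
        drop-β x = trans (+-congˡ β≈0) (+-identityʳ _)
        clear : ∀ w → α * (a * α≉0 ⁻¹ * w ^ Δ r) ≈ a * w ^ Δ r
        clear w = begin
          α * (a * α≉0 ⁻¹ * w ^ Δ r)    ≈⟨ solve 4 (λ α a i W → α :* (a :* i :* W) := (α :* i) :* (a :* W))
                                             refl α a (α≉0 ⁻¹) (w ^ Δ r) ⟩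
          (α * α≉0 ⁻¹) * (a * w ^ Δ r)  ≈⟨ *-congʳ (⁻¹-inverseʳ α≉0) ⟩
          1# * (a * w ^ Δ r)            ≈⟨ *-identityˡ _ ⟩
          a * w ^ Δ r                   ∎

      meet⇔norm : β ≈ 0# → let e = gcd n (gcd k r) in
        Satisfiable (L g ∩ L[ h ] f) ⇔ (norm e (gcd[m,n]∣m n (gcd k r)) (FiniteField._÷_ F a α≉0) ≈ 1#)
      meet⇔norm β≈0 = representable⇔ ΔeM≡Δn 1≤M ⇔-∘ (diagonal⇔representable β≈0 ⇔-∘ meet⇔diagonal)
        where
        e = gcd n (gcd k r)
        instance
          Δe≢0 : ℕ.NonZero (Δ e)
          Δe≢0 = q^e∸1-nonZero q-primePower 2≤n (gcd[m,n]∣m n (gcd k r))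
        ΔeM≡Δn : Δ e ℕ.* (Δ n ℕ./ Δ e) ≡ Δ n
        ΔeM≡Δn = ℕ.m*[n/m]≡n (Δ-∣ (gcd[m,n]∣m n (gcd k r)))
        1≤M : 1 ≤ Δ n ℕ./ Δ e
        1≤M = ℕ.n≢0⇒n>0 λ M≡0 → ℕ.m<n⇒n≢0 (Δ-≥1 1≤n)
          (≡.trans (≡.sym ΔeM≡Δn) (≡.trans (≡.cong (Δ e ℕ.*_) M≡0) (ℕ.*-zeroʳ (Δ e))))

      meet : a ≉ 0# → β ≉ 0# → 1 ≤ k → h ≢ d → 2 ℕ.* (k ℕ.+ r) ≤ n → Satisfiable (L g ∩ L[ h ] f)
      meet a≉0 β≉0 1≤k h≢d 2[k+r]≤n =
        -- Dividing α X + β = a W by β gives (-α/β) X + (a/β) W = 1, whence the two coefficients.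
        let x , w , x≉0 , w≉0 , eq = SecondMoment.diagonal-solvable (Δ-≥1 1≤k) (Δ-≥1 1≤r)
              (*-≉0 -α≉0 (⁻¹-≉0 β≉0)) (*-≉0 a≉0 (⁻¹-≉0 β≉0))
              (ℕ.≤-trans (Δ-large 1≤k 1≤r 2[k+r]≤n) (ℕ.≤-reflexive (≡.sym (suc-Δ n))))
        in Equivalence.from meet⇔diagonal (x , w , x≉0 , w≉0 , solution x w eq)
        where
        1≤r : 1 ≤ r
        1≤r = ℕ.n≢0⇒n>0 (λ r≡0 → h≢d (≡.sym (ℕ.∣m-n∣≡0⇒m≡n r≡0)))
        -α≉0 : - α ≉ 0#
        -α≉0 -α≈0 = α≉0 (trans (sym (+-identityʳ α)) (trans (+-congˡ (sym -α≈0)) (-‿inverseʳ α)))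
        solution : ∀ x w → - α * β≉0 ⁻¹ * x ^ Δ k + a * β≉0 ⁻¹ * w ^ Δ r ≈ 1# → α * x ^ Δ k + β ≈ a * w ^ Δ r
        solution x w eq = begin
          α * X + β                                              ≈⟨ +-congˡ (*-identityʳ β) ⟨
          α * X + β * 1#                                         ≈⟨ +-congˡ (*-congˡ eq) ⟨
          -- To the semiring solver - α is an independent variable; it meets α only in the last
          -- steps.
          α * X + β * (- α * β≉0 ⁻¹ * X + a * β≉0 ⁻¹ * W)        ≈⟨ solve 7 (λ α -α β i X a W →
            α :* X :+ β :* (-α :* i :* X :+ a :* i :* W) := α :* X :+ (β :* i) :* (-α :* X :+ a :* W))
            refl α (- α) β (β≉0 ⁻¹) X a W ⟩
          α * X + (β * β≉0 ⁻¹) * (- α * X + a * W)               ≈⟨ +-congˡ (trans (*-congʳ (⁻¹-inverseʳ β≉0)) (*-identityˡ _)) ⟩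
          α * X + (- α * X + a * W)                              ≈⟨ solve 5 (λ α -α X a W →
            α :* X :+ (-α :* X :+ a :* W) := (α :+ -α) :* X :+ a :* W) refl α (- α) X a W ⟩
          (α + - α) * X + a * W                                  ≈⟨ +-congʳ (trans (*-congʳ (-‿inverseʳ α)) (zeroˡ X)) ⟩
          0# + a * W                                             ≈⟨ +-identityˡ _ ⟩
          a * W                                                  ∎
          where
          X = x ^ Δ k
          W = w ^ Δ r

theorem3p9 : ∀ {c ℓ : Level} (q n : ℕ) (q-primePower : PrimePower q) (2≤n : 2 ≤ n)
    (F : FiniteField (q ℕ.^ n) c ℓ) →
    let open FiniteField F
        open LinearSets q-primePower 2≤n F
    in
    (α β a : Carrier) (α≉0 : α ≉ 0#) (a≉0 : a ≉ 0#)
    (k d h : ℕ) → 1 ≤ k → k < n → d < n → h < n → h ≢ d →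
    let g : Carrier → Carrier
        g x = α * x ^ (q ℕ.^ k) + β * x
        f : Carrier → Carrier
        f y = a * y ^ (q ℕ.^ d)
        e : ℕ
        e = gcd n (gcd k ℕ.∣ d - h ∣)
        e∣n = gcd[m,n]∣m n (gcd k ℕ.∣ d - h ∣)
    in
    (β ≈ 0# → (Satisfiable (L g ∩ L[ h ] f) ⇔ (norm e e∣n (a ÷ α≉0) ≈ 1#)))
    ×
    (β ≉ 0# → 2 ℕ.* (k ℕ.+ ℕ.∣ d - h ∣) ≤ n → Satisfiable (L g ∩ L[ h ] f))
theorem3p9 q n q-primePower 2≤n F α β a α≉0 a≉0 k d h 1≤k _ _ _ h≢d =
  meet⇔norm α β a k d h α≉0 ,
  λ β≉0 → meet α β a k d h α≉0 a≉0 β≉0 1≤k h≢d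
  where open Intersection q-primePower 2≤n F
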